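{- Let the number of groups $m$, the doubling dimension $\lambda$ and $\epsilon\in(0,1]$ be constants. Given an instance $(\mathcal{X},d)$, $\mathcal{X}=\bigcup_{i=1}^m\mathcal{X}_i$, $k_1,\dots,k_m$ of Fair Max-Min diversification whose metric has doubling dimension $\lambda$ (in particular, points in Euclidean space of constant dimension), with $|\mathcal{X}|=n$ and $k=\sum_i k_i$, one can obtain a $(1+\epsilon)$-approximation with perfect fairness, i.e. a set $\mathcal{S}\subseteq\mathcal{X}$ with $\mathrm{div}(\mathcal{S})\ge\ell^*/(1+\epsilon)$ and $|\mathcal{S}\cap\mathcal{X}_i|\ge k_i$ for all $i\in[m]$, by enumerating over all subsets of the coreset $\mathcal{T}$ described in the context and returning the subset with maximum diversity and perfect fairness. The running time of this algorithm is $O(nk)+2^{O(k)}$.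
   Context: Fair Max-Min diversification: the input is a metric space $(\mathcal{X},d)$ with $|\mathcal{X}|=n$, where $\mathcal{X}=\bigcup_{i=1}^m\mathcal{X}_i$ is partitioned into $m$ disjoint groups, and non-negative integers $k_1,\dots,k_m$ with $k_i\le|\mathcal{X}_i|$. For $\mathcal{S}\subseteq\mathcal{X}$ let $\mathrm{div}(\mathcal{S})=\min_{u,v\in\mathcal{S},u\ne v}d(u,v)$. The optimal diversity is $\ell^*=\max\{\mathrm{div}(\mathcal{S}):\mathcal{S}\subseteq\mathcal{X},\ |\mathcal{S}\cap\mathcal{X}_i|=k_i\ \forall i\in[m]\}$. Doubling dimension: write $\mathbf{B}(p,r)=\{q\in\mathcal{X}: d(p,q)<r\}$. The doubling dimension of $\mathcal{X}$ is the smallest integer $\lambda$ such that any ball $\mathbf{B}(p,r)$ of radius $r$ around a point $p\in\mathcal{X}$ can be covered using at most $(r/r')^\lambda$ balls of radius $r'$. Coreset: $\mathrm{GMM}(\mathcal{Y},s)$ is the greedy algorithm that starts with an arbitrary point of $\mathcal{Y}$ and in every subsequent step selects the point of $\mathcal{Y}$ farthest away from the previously selected points, until $s$ points are selected. With $\epsilon'=\epsilon/(1+\epsilon)$, let $T_i=\mathrm{GMM}(\mathcal{X}_i,(4/\epsilon')^\lambda k)$ and $\mathcal{T}=\bigcup_{i=1}^m T_i$. This $\mathcal{T}$ is a $(1+\epsilon)$-coreset, i.e. it contains a subset $\mathcal{T}'$ with $|\mathcal{T}'\cap\mathcal{X}_i|=k_i$ for all $i$ and $\mathrm{div}(\ma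thcal{T}')\ge\ell^*/(1+\epsilon)$.
   Formalization: The doubling condition is required only for r' ≤ r/2 (for all r' ≤ r no finite space with two or more points satisfies it); the running time bound is for k ≥ 1, and the Euclidean example is not stated separately. -}

module Defs where

open import Algebra.Bundles using (CommutativeRing; Semiring)
import Algebra.Definitions.RawSemiring as SemiringOps
open import Data.Bool.Base using (Bool; true; false; if_then_else_; _∧_)
open import Data.Fin.Base using (Fin)
open import Data.Fin.Properties using (all?; _≟_)
open import Data.Fin.Subset using (Subset; inside; outside; _∩_; ⋃; ⁅_⁆; ∣_∣)
open import Data.Fin.Subset.Properties using (_∈?_)
open import Data.List.Base using
  (List; []; _∷_; _++_; map; filter; length; allFin; cartesianProduct)
import Data.List.Extrema
open import Data.List.Membership.Propositional using (_∈_)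
open import Data.Maybe.Base using (Maybe; just; nothing)
open import Data.Nat.Base as ℕ using (ℕ; zero; suc)
open import Data.Nat.ListAction using (sum)
import Data.Nat.Properties as ℕ
open import Data.Product.Base using (∃; _×_; _,_; proj₁; proj₂)
import Data.Vec.Base as Vec
open import Function.Metric.Structures using (IsGeneralMetric)
open import Level using (Level; _⊔_) renaming (suc to lsuc)
open import Relation.Binary.Bundles using (TotalOrder)
import Relation.Binary.Construct.Add.Supremum.NonStrict as AddSupremum
import Relation.Binary.Construct.NonStrictToStrict as ToStrict
open import Relation.Binary.PropositionalEquality.Core using (_≡_)
open import Relation.Binary.Structures using (IsDecTotalOrder)
open import Relation.Nullary.Construct.Add.Supremum using (_⁺; [_]; ⊤⁺)
open import Relation.Nullary.Decidable using (does; _×-dec_; ¬?)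
open import Relation.Nullary.Negation using (¬_)
open import Relation.Unary using (Decidable)

-- Distances, radii and ε live in an arbitrary Archimedean ordered field with
-- decidable order; classically, ℝ is one.  Deciding the order in one step is
-- the usual real-RAM assumption.  The inverse is total, with an unspecified
-- value at 0#.

record ArchimedeanOrderedField (c ℓ₁ ℓ₂ : Level) : Set (lsuc (c ⊔ ℓ₁ ⊔ ℓ₂)) where
  field
    commutativeRing : CommutativeRing c ℓ₁
  open CommutativeRing commutativeRing public
  open SemiringOps (Semiring.rawSemiring semiring) public using (_^_) renaming (_×_ to _·_)

  infix  4 _≤_
  infix  8 _⁻¹
  field
    _≤_             : Carrier → Carrier → Set ℓ₂
    isDecTotalOrder : IsDecTotalOrder _≈_ _≤_
    _⁻¹             : Carrier → Carrier
    1≉0             : ¬ 1# ≈ 0#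
    ⁻¹-inverse      : ∀ {x} → ¬ x ≈ 0# → x * x ⁻¹ ≈ 1#
    +-monoʳ-≤       : ∀ z {x y} → x ≤ y → z + x ≤ z + y
    *-nonNegative   : ∀ {x y} → 0# ≤ x → 0# ≤ y → 0# ≤ x * y
    archimedean     : ∀ x → ∃ λ n → x ≤ n · 1#

  open IsDecTotalOrder isDecTotalOrder public using (_≤?_; isTotalOrder)
  open ToStrict _≈_ _≤_ public using (_<_)

-- A computation together with the number of elementary steps it performs.
-- Programs below are written so that every function call and every
-- elementary operation (a distance query, a field operation, a comparison
-- of scalars or indices, a unit of list handling) is charged one `step`.

record Timed {a} (A : Set a) : Set a where
  constructor timed
  field
    value : A
    cost  : ℕ

open Timed public

infixl 1 _>>=_
_>>=_ : ∀ {a b} {A : Set a} {B : Set b} → Timed A → (A → Timed B) → Timed B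
timed x s >>= f = timed (value (f x)) (s ℕ.+ cost (f x))

step : ∀ {a} {A : Set a} → A → Timed A
step x = timed x 1

allSubsets : ∀ n → List (Subset n)
allSubsets zero    = Vec.[] ∷ []
allSubsets (suc n) = map (inside Vec.∷_) (allSubsets n) ++ map (outside Vec.∷_) (allSubsets n)

module FairDiversification {c ℓ₁ ℓ₂} (F : ArchimedeanOrderedField c ℓ₁ ℓ₂) where

  open ArchimedeanOrderedField F
  open AddSupremum _≤_ public using (_≤⁺_)
  open AddSupremum _≤_ using (≤⁺-dec; ≤⁺-isTotalOrder)

  -- Scalars extended by +∞, the diversity of sets with at most one point.
  extended : TotalOrder _ _ _
  extended = record { isTotalOrder = ≤⁺-isTotalOrder isTotalOrder }

  open Data.List.Extrema extended using (min; max)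

  infixl 7 _/⁺_
  _/⁺_ : Carrier ⁺ → Carrier → Carrier ⁺
  [ x ] /⁺ y = [ x * y ⁻¹ ]
  ⊤⁺    /⁺ y = ⊤⁺

  -- The map `group` encodes the partition into m disjoint groups.
  record Instance (m : ℕ) : Set (c ⊔ ℓ₁ ⊔ ℓ₂) where
    field
      n        : ℕ
      d        : Fin n → Fin n → Carrier
      isMetric : IsGeneralMetric _≡_ _≈_ _≤_ 0# _+_ d
      group    : Fin n → Fin m
      k        : Fin m → ℕ

    Point : Set
    Point = Fin n

    X : Fin m → Subset n
    X i = Vec.tabulate λ x → does (group x ≟ i)

    field
      k≤∣X∣ : ∀ i → k i ℕ.≤ ∣ X i ∣

    kTotal : ℕ
    kTotal = sum (map k (allFin m))

  module _ {m : ℕ} (I : Instance m) where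

    open Instance I

    div : Subset n → Carrier ⁺
    div S = min ⊤⁺ (map (λ (u , v) → [ d u v ])
      (filter (λ (u , v) → (u ∈? S) ×-dec (v ∈? S) ×-dec ¬? (u ≟ v))
              (cartesianProduct (allFin n) (allFin n))))

    Exact : Subset n → Set
    Exact S = ∀ i → ∣ S ∩ X i ∣ ≡ k i

    Fair : Subset n → Set
    Fair S = ∀ i → k i ℕ.≤ ∣ S ∩ X i ∣

    exact? : Decidable Exact
    exact? S = all? λ i → ∣ S ∩ X i ∣ ℕ.≟ k i

    -- The maximum is over a non-empty list of non-negative values, since
    -- k i ≤ ∣ X i ∣, so the default 0# does not affect it.
    ℓ* : Carrier ⁺
    ℓ* = max [ 0# ] (map div (filter exact? (allSubsets n)))

    Ball : Point → Carrier → Point → Set (ℓ₁ ⊔ ℓ₂)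
    Ball p r q = d p q < r

    -- Radii are restricted to r′ ≤ r / 2.  For ratios r / r′ close to 1 the
    -- requirement fails in every finite space with two points u, v at minimal
    -- distance δ: for r slightly above δ = r′, a single ball of radius δ, which
    -- is a singleton, would have to cover the ball of radius r around u.
    Doubling : ℕ → Set (c ⊔ ℓ₁ ⊔ ℓ₂)
    Doubling dim = ∀ p r r′ → 0# < r′ → r′ + r′ ≤ r →
      ∃ λ (centres : List Point) →
        (length centres · 1# ≤ (r * r′ ⁻¹) ^ dim) ×
        (∀ q → Ball p r q → ∃ λ o → (o ∈ centres) × Ball o r′ q)

    IsDoublingDimension : ℕ → Set (c ⊔ ℓ₁ ⊔ ℓ₂)
    IsDoublingDimension dim = Doubling dim × (∀ dim′ → Doubling dim′ → dim ℕ.≤ dim′)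

    ⟦_⟧ : List Point → Subset n
    ⟦ xs ⟧ = ⋃ (map ⁅_⁆ xs)

    -- GMM: each point not yet selected is kept with its distance to the
    -- selected points, so that a round takes linear time.  The arbitrary
    -- first point is the head of the input; the numbering of the points by
    -- Fin n being arbitrary, this is no restriction.  GMM stops early when
    -- the points are exhausted.

    Tagged : Set c
    Tagged = Point × Carrier

    extractFarthest : Tagged → List Tagged → Timed (Tagged × List Tagged)
    extractFarthest z []       = step (z , [])
    extractFarthest z (w ∷ ws) = do
      (b , rest) ← extractFarthest w ws
      b≤z        ← step (does (proj₂ b ≤? proj₂ z))
      step (if b≤z then (z , b ∷ rest) else (b , z ∷ rest))

    tag : Point → List Point → Timed (List Tagged)
    tag y []       = step []
    tag y (x ∷ xs) = do
      δ  ← step (d y x)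
      zs ← tag y xs
      step ((x , δ) ∷ zs)

    retag : Point → List Tagged → Timed (List Tagged)
    retag y []             = step []
    retag y ((x , δ) ∷ zs) = do
      δ′   ← step (d y x)
      δ′≤δ ← step (does (δ′ ≤? δ))
      zs′  ← retag y zs
      step ((x , (if δ′≤δ then δ′ else δ)) ∷ zs′)

    extend : ℕ → List Tagged → Timed (List Point)
    extend zero    zs       = step []
    extend (suc s) []       = step []
    extend (suc s) (z ∷ zs) = do
      ((y , _) , rest) ← extractFarthest z zs
      rest′            ← retag y rest
      ys               ← extend s rest′
      step (y ∷ ys)

    gmm : List Point → ℕ → Timed (List Point)
    gmm xs       zero    = step []
    gmm []       (suc s) = step []
    gmm (x ∷ xs) (suc s) = do
      zs ← tag x xs
      ys ← extend s zs
      step (x ∷ ys)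

    powerᵗ : Carrier → ℕ → Timed Carrier
    powerᵗ x zero    = step 1#
    powerᵗ x (suc e) = do
      y ← powerᵗ x e
      step (x * y)

    scalarᵗ : ℕ → Timed Carrier
    scalarᵗ zero    = step 0#
    scalarᵗ (suc j) = do
      y ← scalarᵗ j
      step (1# + y)

    -- ⌈ x ⌉, or 0 for negative x, provided that x ≤ fuel · 1#.
    ceilingᵗ : (fuel : ℕ) → Carrier → Timed ℕ
    ceilingᵗ zero       x = step 0
    ceilingᵗ (suc fuel) x = do
      x≤0 ← step (does (x ≤? 0#))
      if x≤0 then step 0 else (do
        y ← step (x - 1#)
        j ← ceilingᵗ fuel y
        step (suc j))

    sumᵗ : List (Fin m) → Timed ℕ
    sumᵗ []       = step 0
    sumᵗ (i ∷ is) = do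
      j ← sumᵗ is
      step (k i ℕ.+ j)

    -- ⌈ (4 / ε′) ^ dim * k ⌉ where ε′ = ε / (1 + ε).
    gmmSize : ℕ → Carrier → Timed ℕ
    gmmSize dim ε = do
      u  ← step (1# + ε)
      v  ← step (u ⁻¹)
      ε′ ← step (ε * v)
      w  ← step (ε′ ⁻¹)
      b  ← step ((4 · 1#) * w)
      p  ← powerᵗ b dim
      j  ← sumᵗ (allFin m)
      q  ← scalarᵗ j
      x  ← step (p * q)
      ceilingᵗ (proj₁ (archimedean x)) x

    membersᵗ : Fin m → List Point → Timed (List Point)
    membersᵗ i []       = step []
    membersᵗ i (x ∷ xs) = do
      x∈Xᵢ ← step (does (group x ≟ i))
      ys   ← membersᵗ i xs
      step (if x∈Xᵢ then x ∷ ys else ys)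

    appendᵗ : ∀ {a} {A : Set a} → List A → List A → Timed (List A)
    appendᵗ []       ys = step ys
    appendᵗ (x ∷ xs) ys = do
      zs ← appendᵗ xs ys
      step (x ∷ zs)

    coreset : ℕ → List (Fin m) → Timed (List Point)
    coreset s []       = step []
    coreset s (i ∷ is) = do
      xs ← membersᵗ i (allFin n)
      T  ← gmm xs s
      Ts ← coreset s is
      appendᵗ T Ts

    consAllᵗ : Point → List (List Point) → Timed (List (List Point))
    consAllᵗ x []         = step []
    consAllᵗ x (ys ∷ yss) = do
      zss ← consAllᵗ x yss
      step ((x ∷ ys) ∷ zss)

    sublistsᵗ : List Point → Timed (List (List Point))
    sublistsᵗ []       = step ([] ∷ [])
    sublistsᵗ (x ∷ xs) = do
      yss ← sublistsᵗ xs
      zss ← consAllᵗ x yss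
      appendᵗ zss yss

    minᵗ : Carrier ⁺ → Carrier ⁺ → Timed (Carrier ⁺)
    minᵗ x y = do
      x≤y ← step (does (≤⁺-dec _≤?_ x y))
      step (if x≤y then x else y)

    nearestᵗ : Point → List Point → Timed (Carrier ⁺)
    nearestᵗ x []       = step ⊤⁺
    nearestᵗ x (y ∷ ys) = do
      δ ← step (d x y)
      e ← nearestᵗ x ys
      minᵗ [ δ ] e

    divᵗ : List Point → Timed (Carrier ⁺)
    divᵗ []       = step ⊤⁺
    divᵗ (x ∷ xs) = do
      e  ← nearestᵗ x xs
      e′ ← divᵗ xs
      minᵗ e e′

    countᵗ : Fin m → List Point → Timed ℕ
    countᵗ i []       = step 0
    countᵗ i (x ∷ xs) = do
      x∈Xᵢ ← step (does (group x ≟ i))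
      j    ← countᵗ i xs
      step (if x∈Xᵢ then suc j else j)

    fairᵗ : List Point → List (Fin m) → Timed Bool
    fairᵗ xs []       = step true
    fairᵗ xs (i ∷ is) = do
      j  ← countᵗ i xs
      b  ← step (does (k i ℕ.≤? j))
      b′ ← fairᵗ xs is
      step (b ∧ b′)

    betterᵗ : List Point → Carrier ⁺ → Maybe (List Point × Carrier ⁺) →
              Timed (Maybe (List Point × Carrier ⁺))
    betterᵗ xs e nothing         = step (just (xs , e))
    betterᵗ xs e (just (ys , f)) = do
      e≤f ← step (does (≤⁺-dec _≤?_ e f))
      step (just (if e≤f then (ys , f) else (xs , e)))

    -- A fair member of the list of maximum diversity, if there is a fair one.
    bestᵗ : List (List Point) → Timed (Maybe (List Point × Carrier ⁺))
    bestᵗ []         = step nothing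
    bestᵗ (xs ∷ xss) = do
      r    ← bestᵗ xss
      fair ← fairᵗ xs (allFin m)
      if fair
        then (do e ← divᵗ xs
                 betterᵗ xs e r)
        else step r

    solution : Maybe (List Point × Carrier ⁺) → Maybe (List Point)
    solution nothing         = nothing
    solution (just (xs , _)) = just xs

    fairMaxMin : (dim : ℕ) (ε : Carrier) → Timed (Maybe (List Point))
    fairMaxMin dim ε = do
      s   ← gmmSize dim ε
      T   ← coreset s (allFin m)
      xss ← sublistsᵗ T
      r   ← bestᵗ xss
      step (solution r)

{-# OPTIONS --safe #-}

-- Fix a fair set S whose points are pairwise at distance at least L, and let
-- b = 4/ε′ and ρ = L/b, so that L/(1+ε) = L - 4ρ.  In each group, GMM either
-- comes within 2ρ of every point, or selects s ≥ b^λ·k points that are pairwise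
-- more than 2ρ apart.  In the first case the points of S in the group move to
-- their nearest selected points, which costs at most 4ρ per distance.  In the
-- second case fresh points at distance at least L from all points chosen so far
-- are taken greedily: balls of radius L around fewer than k points are covered by
-- fewer than b^λ·k balls of radius ρ, each containing at most one selected point,
-- so some selected point lies outside of them.  Hence the coreset contains a fair
-- set of diversity at least L/(1+ε), and the enumeration finds one.
--
-- For the running time, s ≤ Pk with P ≥ b^λ a constant, so GMM takes time O(nk), and the
-- coreset has at most mPk points, hence 2^O(k) subsets.

module Submission where

import Algebra.Properties.Ring as RingProperties
import Algebra.Properties.Semiring.Exp as Exp
import Algebra.Properties.Semiring.Mult as Mult
open import Data.Bool.Base using (Bool; true; false; T; if_then_else_)
open import Data.Fin.Base using (Fin; zero; suc)
open import Data.Fin.Properties using (_≟_; suc-injective)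
open import Data.Fin.Subset as Subset using (Subset; inside; outside; ⁅_⁆; ∣_∣; _∩_)
open import Data.Fin.Subset.Properties
  using (∉⊥; x∈⁅x⁆; x∈⁅y⁆⇒x≡y; x∈p∩q⁺; x∈p∩q⁻; x∈p∪q⁺; x∈p∪q⁻; ∩-identityˡ)
  renaming (_∈?_ to _∈ˢ?_)
open import Data.List.Base hiding ([_]; sum; find)
import Data.List.Extrema
import Data.List.Membership.DecPropositional as DecMembership
open import Data.List.Membership.Propositional using (_∈_; find; lose)
open import Data.List.Membership.Propositional.Properties
open import Data.List.Properties
  using (length-++; length-map; length-removeAt′; length-tabulate; length-take; map-++; take++drop≡id)
open import Data.List.Relation.Binary.Permutation.Propositional
  using (_↭_; prep; swap; ↭-refl; ↭-sym; ↭-trans; ↭⇒↭ₛ; ↭-reflexive)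
open import Data.List.Relation.Binary.Permutation.Propositional.Properties as ↭
  using (All-resp-↭; ∈-resp-↭; ↭-length; shift; filter-↭)
import Data.List.Relation.Binary.Permutation.Setoid.Properties as Permutationₛ
open import Data.List.Relation.Binary.Pointwise using (Pointwise; []; _∷_)
open import Data.List.Relation.Binary.Subset.Propositional using (_⊆_)
open import Data.List.Relation.Unary.All as All using (All; []; _∷_)
import Data.List.Relation.Unary.All.Properties as All
open import Data.List.Relation.Unary.AllPairs as AllPairs using (AllPairs; []; _∷_)
import Data.List.Relation.Unary.AllPairs.Properties as AllPairs
open import Data.List.Relation.Unary.Any as Any using (Any; here; there)
import Data.List.Relation.Unary.Any.Properties as Any
open import Data.List.Relation.Unary.Unique.Propositional using (Unique)
import Data.List.Relation.Unary.Unique.Propositional.Properties as Unique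
open import Data.Maybe.Base using (Maybe; just; nothing)
open import Data.Nat.Base as ℕ using (ℕ; zero; suc; s≤s; z≤n)
open import Data.Nat.ListAction using (sum)
import Data.Nat.Properties as ℕ
open import Data.Nat.Tactic.RingSolver using (solve-∀)
open import Data.Product.Base using (∃; ∃₂; _×_; _,_; proj₁; proj₂)
open import Data.Sum.Base as Sum using (_⊎_; inj₁; inj₂)
open import Data.Unit.Base using (tt)
import Data.Vec.Base as Vec
import Data.Vec.Properties as Vec
open import Function.Base using (_∘_; id)
open import Function.Metric.Structures using (IsGeneralMetric)
open import Level using (Level; _⊔_)
open import Relation.Binary.Bundles using (TotalOrder)
import Relation.Binary.Construct.Add.Supremum.NonStrict as AddSupremum
import Relation.Binary.Construct.NonStrictToStrict as ToStrict
open import Relation.Binary.Core using (Rel)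
open import Relation.Binary.Definitions using (Symmetric)
open import Relation.Binary.PropositionalEquality
  using (_≡_; _≢_; refl; sym; trans; cong; cong₂; subst; subst₂; setoid)
import Relation.Binary.Reasoning.PartialOrder
open import Relation.Binary.Structures using (IsDecTotalOrder)
open import Relation.Nullary.Construct.Add.Supremum using (_⁺; [_]; ⊤⁺)
open import Relation.Nullary.Decidable.Core using (Dec; yes; no; does; _×-dec_; ¬?)
open import Relation.Nullary.Negation.Core using (¬_; contradiction)
open import Defs

-- Counting and splitting in lists.

private
  variable
    a b p q r : Level
    A : Set a
    B : Set b

-- The entry at `i` satisfies `P` and hence not `Q`, so the witness of `Q` sits at another position
-- and survives the removal.
delete⁺ : {P : A → Set p} {Q : A → Set q} {xs : List A} → (∀ {x} → P x → ¬ Q x) →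
          (i : Any P xs) → Any Q xs → Any Q (xs Any.─ i)
delete⁺ P∩Q=∅ (here px) (here qx) = contradiction qx (P∩Q=∅ px)
delete⁺ P∩Q=∅ (here px) (there j) = j
delete⁺ P∩Q=∅ (there i) (here qx) = here qx
delete⁺ P∩Q=∅ (there i) (there j) = there (delete⁺ P∩Q=∅ i j)

-- By induction on `xs`: the entry of `ys` matched to the head is removed, and by exclusivity every
-- later `x` keeps its own match in the shortened list. A relation replaces a function because it is
-- applied to covering balls, where only the existence of a centre is known.
pigeonhole : {R : A → B → Set r} {xs : List A} {ys : List B} →
             All (λ x → Any (R x) ys) xs →
             AllPairs (λ x x′ → ∀ y → R x y → ¬ R x′ y) xs →
             length xs ℕ.≤ length ys
pigeonhole []       []       = z≤n
pigeonhole {R = R} {ys = ys} (i ∷ is) (q ∷ qs) = subst (_ ℕ.≤_) (sym (length-removeAt′ ys (Any.index i)))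
  (s≤s (pigeonhole (All.zipWith (λ {x′} (disj , j) → delete⁺ {P = R _} {Q = R x′} (disj _) i j) (q , is)) qs))

unique-⊆⇒length≤ : {xs ys : List A} → Unique xs → xs ⊆ ys → length xs ℕ.≤ length ys
unique-⊆⇒length≤ xs! xs⊆ys = pigeonhole (All.tabulate xs⊆ys)
  (AllPairs.map (λ x≢x′ y x≡y x′≡y → x≢x′ (trans x≡y (sym x′≡y))) xs!)

allPairs⁺ : {R : Rel A r} {xs : List A} → Unique xs →
            (∀ {x y} → x ∈ xs → y ∈ xs → x ≢ y → R x y) → AllPairs R xs
allPairs⁺ []           f = []
allPairs⁺ (x∉xs ∷ xs!) f =
  All.tabulate (λ y∈xs → f (here refl) (there y∈xs) (All.lookup x∉xs y∈xs)) ∷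
  allPairs⁺ xs! (λ x∈xs y∈xs → f (there x∈xs) (there y∈xs))

allPairs-lookup : {R : Rel A r} → Symmetric R → {xs : List A} {x y : A} → AllPairs R xs →
                  x ∈ xs → y ∈ xs → x ≢ y → R x y
allPairs-lookup R-sym (rs ∷ _)  (here refl) (here refl) x≢y = contradiction refl x≢y
allPairs-lookup R-sym (rs ∷ _)  (here refl) (there y∈)  x≢y = All.lookup rs y∈
allPairs-lookup R-sym (rs ∷ _)  (there x∈)  (here refl) x≢y = R-sym (All.lookup rs x∈)
allPairs-lookup R-sym (_ ∷ rss) (there x∈)  (there y∈)  x≢y = allPairs-lookup R-sym rss x∈ y∈ x≢y

-- Subsets of `Fin n` as duplicate-free lists.

elements : ∀ {n} → Subset n → List (Fin n)
elements Vec.[]              = []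
elements (inside Vec.∷ S)  = zero ∷ map suc (elements S)
elements (outside Vec.∷ S) = map suc (elements S)

length-elements : ∀ {n} (S : Subset n) → length (elements S) ≡ ∣ S ∣
length-elements Vec.[]              = refl
length-elements (inside Vec.∷ S)  = cong suc (trans (length-map suc (elements S)) (length-elements S))
length-elements (outside Vec.∷ S) = trans (length-map suc (elements S)) (length-elements S)

∈-elements⁺ : ∀ {n} {S : Subset n} {x} → x Subset.∈ S → x ∈ elements S
∈-elements⁺ Vec.here                                = here refl
∈-elements⁺ {S = inside Vec.∷ S}  (Vec.there x∈S) = there (∈-map⁺ suc (∈-elements⁺ x∈S))
∈-elements⁺ {S = outside Vec.∷ S} (Vec.there x∈S) = ∈-map⁺ suc (∈-elements⁺ x∈S)

∈-elements⁻ : ∀ {n} (S : Subset n) {x} → x ∈ elements S → x Subset.∈ S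
∈-elements⁻ (inside Vec.∷ S) (here refl) = Vec.here
∈-elements⁻ (inside Vec.∷ S) (there x∈)
  with _ , y∈ , refl ← ∈-map⁻ suc x∈ = Vec.there (∈-elements⁻ S y∈)
∈-elements⁻ (outside Vec.∷ S) x∈
  with _ , y∈ , refl ← ∈-map⁻ suc x∈ = Vec.there (∈-elements⁻ S y∈)

elements-unique : ∀ {n} (S : Subset n) → Unique (elements S)
elements-unique Vec.[]              = []
elements-unique (inside Vec.∷ S)  =
  All.map⁺ (All.universal (λ _ ()) (elements S)) ∷ Unique.map⁺ suc-injective (elements-unique S)
elements-unique (outside Vec.∷ S) = Unique.map⁺ suc-injective (elements-unique S)

Unique-resp-↭ : {xs ys : List A} → xs ↭ ys → Unique xs → Unique ys
Unique-resp-↭ = Permutationₛ.Unique-resp-↭ (setoid _) ∘ ↭⇒↭ₛ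

-- `P` and `Q` may overlap; the given choice decides. `R` is kept for the first block only, since
-- among the points of a fair set only those to be replaced rely on their old distances.
separate : {P : A → Set p} {Q : A → Set q} {R : Rel A r} → (∀ x → P x ⊎ Q x) → {xs : List A} → AllPairs R xs →
           ∃₂ λ ys zs → xs ↭ ys ++ zs × All P ys × All Q zs × AllPairs R ys
separate P⊎Q []               = [] , [] , ↭-refl , [] , [] , []
separate P⊎Q (_∷_ {x} x~ ~xs) with P⊎Q x | separate P⊎Q ~xs
... | inj₁ px | ys , zs , xs↭ , pys , qzs , ~ys =
  x ∷ ys , zs , prep x xs↭ , px ∷ pys , qzs , All.++⁻ˡ ys (All-resp-↭ xs↭ x~) ∷ ~ys
... | inj₂ qx | ys , zs , xs↭ , pys , qzs , ~ys =
  ys , x ∷ zs , ↭-trans (prep x xs↭) (↭-sym (shift x ys zs)) , pys , qx ∷ qzs , ~ys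

-- Serves to absorb lengths and constant factors into powers of two.
m<2^m : ∀ j → j ℕ.< 2 ℕ.^ j
m<2^m zero    = s≤s z≤n
m<2^m (suc j) = ℕ.≤-trans (ℕ.+-mono-≤ (ℕ.m^n>0 2 j) (m<2^m j)) (ℕ.≤-reflexive (double (2 ℕ.^ j)))
  where
  double : ∀ w → w ℕ.+ w ≡ 2 ℕ.* w
  double = solve-∀

-- Arithmetic in an Archimedean ordered field.

module OrderedField {c ℓ₁ ℓ₂} (F : ArchimedeanOrderedField c ℓ₁ ℓ₂) where

  open ArchimedeanOrderedField F hiding (refl; sym; trans)
  private module ≈ = ArchimedeanOrderedField F
  open IsDecTotalOrder isDecTotalOrder public
    using (≤-respˡ-≈; ≤-respʳ-≈)
    renaming (refl to ≤-refl; reflexive to ≤-reflexive; trans to ≤-trans;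
              antisym to ≤-antisym; total to ≤-total)
  open RingProperties ring using (-‿distribˡ-*; -‿involutive)
  open Mult semiring using (×-homo-+; ×1-homo-*) public
  open Exp semiring using (^-congˡ) public

  totalOrder : TotalOrder c ℓ₁ ℓ₂
  totalOrder = record { isTotalOrder = isTotalOrder }

  module ≤-Reasoning = Relation.Binary.Reasoning.PartialOrder (TotalOrder.poset totalOrder)
  open ≤-Reasoning

  ≰⇒> : ∀ {x y} → ¬ x ≤ y → y < x
  ≰⇒> = ToStrict.≰⇒> _≈_ _≤_ ≈.sym ≤-reflexive ≤-total

  <⇒≱ : ∀ {x y} → x < y → ¬ y ≤ x
  <⇒≱ = ToStrict.<⇒≱ _≈_ _≤_ ≤-antisym

  ≰⇒≥ : ∀ {x y} → ¬ x ≤ y → y ≤ x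
  ≰⇒≥ = proj₁ ∘ ≰⇒>

  <-≤-trans : ∀ {x y z} → x < y → y ≤ z → x < z
  <-≤-trans = ToStrict.<-≤-trans _≈_ _≤_ ≈.sym ≤-trans ≤-antisym ≤-respʳ-≈

  ≤-<-trans : ∀ {x y z} → x ≤ y → y < z → x < z
  ≤-<-trans = ToStrict.≤-<-trans _≈_ _≤_ ≤-trans ≤-antisym ≤-respˡ-≈

  +-monoˡ-≤ : ∀ z {x y} → x ≤ y → x + z ≤ y + z
  +-monoˡ-≤ z {x} {y} x≤y = begin
    x + z  ≈⟨ +-comm x z ⟩
    z + x  ≤⟨ +-monoʳ-≤ z x≤y ⟩
    z + y  ≈⟨ +-comm z y ⟩
    y + z  ∎

  +-mono-≤ : ∀ {x y u v} → x ≤ y → u ≤ v → x + u ≤ y + v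
  +-mono-≤ {x} {y} {u} {v} x≤y u≤v = ≤-trans (+-monoˡ-≤ u x≤y) (+-monoʳ-≤ y u≤v)

  +-cancelˡ-≤ : ∀ z {x y} → z + x ≤ z + y → x ≤ y
  +-cancelˡ-≤ z {x} {y} z+x≤z+y = begin
    x              ≈⟨ uncancel x ⟩
    - z + (z + x)  ≤⟨ +-monoʳ-≤ (- z) z+x≤z+y ⟩
    - z + (z + y)  ≈⟨ uncancel y ⟨
    y              ∎
    where
    uncancel : ∀ t → t ≈ - z + (z + t)
    uncancel t = begin-equality
      t              ≈⟨ +-identityˡ t ⟨
      0# + t         ≈⟨ +-congʳ (-‿inverseˡ z) ⟨
      - z + z + t    ≈⟨ +-assoc (- z) z t ⟩
      - z + (z + t)  ∎

  x≤x+y : ∀ x {y} → 0# ≤ y → x ≤ x + y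
  x≤x+y x {y} 0≤y = begin
    x       ≈⟨ +-identityʳ x ⟨
    x + 0#  ≤⟨ +-monoʳ-≤ x 0≤y ⟩
    x + y   ∎

  x-y+y≈x : ∀ x y → x - y + y ≈ x
  x-y+y≈x x y = begin-equality
    x - y + y      ≈⟨ +-assoc x (- y) y ⟩
    x + (- y + y)  ≈⟨ +-congˡ (-‿inverseˡ y) ⟩
    x + 0#         ≈⟨ +-identityʳ x ⟩
    x              ∎

  x≤y⇒0≤y-x : ∀ {x y} → x ≤ y → 0# ≤ y - x
  x≤y⇒0≤y-x {x} {y} x≤y = begin
    0#     ≈⟨ -‿inverseʳ x ⟨
    x - x  ≤⟨ +-monoˡ-≤ (- x) x≤y ⟩
    y - x  ∎

  x-y≤z⇒x≤y+z : ∀ {x y z} → x - y ≤ z → x ≤ y + z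
  x-y≤z⇒x≤y+z {x} {y} {z} x-y≤z = begin
    x          ≈⟨ x-y+y≈x x y ⟨
    x - y + y  ≤⟨ +-monoˡ-≤ y x-y≤z ⟩
    z + y      ≈⟨ +-comm z y ⟩
    y + z      ∎

  x≤y+z⇒x-y≤z : ∀ {x y z} → x ≤ y + z → x - y ≤ z
  x≤y+z⇒x-y≤z {x} {y} {z} x≤y+z = +-cancelˡ-≤ y (begin
    y + (x - y)  ≈⟨ +-comm y (x - y) ⟩
    x - y + y    ≈⟨ x-y+y≈x x y ⟩
    x            ≤⟨ x≤y+z ⟩
    y + z        ∎)

  *-monoˡ-≤ : ∀ {z x y} → 0# ≤ z → x ≤ y → z * x ≤ z * y
  *-monoˡ-≤ {z} {x} {y} 0≤z x≤y = begin
    z * x                ≤⟨ x≤x+y (z * x) (*-nonNegative 0≤z (x≤y⇒0≤y-x x≤y)) ⟩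
    z * x + z * (y - x)  ≈⟨ distribˡ z x (y - x) ⟨
    z * (x + (y - x))    ≈⟨ *-congˡ (≈.trans (+-comm x (y - x)) (x-y+y≈x y x)) ⟩
    z * y                ∎

  *-monoʳ-≤ : ∀ {z x y} → 0# ≤ z → x ≤ y → x * z ≤ y * z
  *-monoʳ-≤ {z} {x} {y} 0≤z x≤y = begin
    x * z  ≈⟨ *-comm x z ⟩
    z * x  ≤⟨ *-monoˡ-≤ 0≤z x≤y ⟩
    z * y  ≈⟨ *-comm z y ⟩
    y * z  ∎

  -- If `1# ≤ 0#`, then minus one is non-negative, and so is its square, which is `1#`.
  0≤1 : 0# ≤ 1#
  0≤1 with ≤-total 0# 1#
  ... | inj₁ 0≤1 = 0≤1
  ... | inj₂ 1≤0 = begin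
    0#                  ≤⟨ *-nonNegative 0≤-1 0≤-1 ⟩
    (0# - 1#) * (0# - 1#)  ≈⟨ *-cong (+-identityˡ _) (+-identityˡ _) ⟩
    - 1# * - 1#         ≈⟨ -‿distribˡ-* 1# (- 1#) ⟨
    - (1# * - 1#)       ≈⟨ -‿cong (*-identityˡ (- 1#)) ⟩
    - - 1#              ≈⟨ -‿involutive 1# ⟩
    1#                  ∎
    where 0≤-1 = x≤y⇒0≤y-x 1≤0

  0<1 : 0# < 1#
  0<1 = 0≤1 , 1≉0 ∘ ≈.sym

  x<x+1 : ∀ x → x < x + 1#
  x<x+1 x = x≤x+y x 0≤1 , λ x≈x+1 → 1≉0 (≤-antisym
    (+-cancelˡ-≤ x (≤-reflexive (≈.trans (≈.sym x≈x+1) (≈.sym (+-identityʳ x))))) 0≤1)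

  0≤n·1 : ∀ n → 0# ≤ n · 1#
  0≤n·1 zero    = ≤-refl
  0≤n·1 (suc n) = ≤-trans 0≤1 (x≤x+y 1# (0≤n·1 n))

  ·1-mono-≤ : ∀ {m n} → m ℕ.≤ n → m · 1# ≤ n · 1#
  ·1-mono-≤ {n = n} z≤n = 0≤n·1 n
  ·1-mono-≤ (s≤s m≤n) = +-monoʳ-≤ 1# (·1-mono-≤ m≤n)

  -- Brings counting inequalities obtained in the field back to natural numbers. The case of a
  -- successor below zero would give `1# ≤ 0#`.
  ·1-cancel-≤ : ∀ m n → m · 1# ≤ n · 1# → m ℕ.≤ n
  ·1-cancel-≤ zero    n       _       = z≤n
  ·1-cancel-≤ (suc m) zero    1+m≤0   = contradiction (≤-trans (x≤x+y 1# (0≤n·1 m)) 1+m≤0) (<⇒≱ 0<1)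
  ·1-cancel-≤ (suc m) (suc n) 1+m≤1+n = s≤s (·1-cancel-≤ m n (+-cancelˡ-≤ 1# 1+m≤1+n))

  0<x⇒x≉0 : ∀ {x} → 0# < x → ¬ x ≈ 0#
  0<x⇒x≉0 (_ , 0≉x) = 0≉x ∘ ≈.sym

  -- A non-positive inverse would force `1#`, which is `x * x ⁻¹`, to be at most `0#`.
  ⁻¹-pos : ∀ {x} → 0# < x → 0# < x ⁻¹
  ⁻¹-pos {x} 0<x@(0≤x , _) = ≰⇒> λ x⁻¹≤0 → <⇒≱ 0<1 (begin
    1#        ≈⟨ ⁻¹-inverse (0<x⇒x≉0 0<x) ⟨
    x * x ⁻¹  ≤⟨ *-monoˡ-≤ 0≤x x⁻¹≤0 ⟩
    x * 0#    ≈⟨ zeroʳ x ⟩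
    0#        ∎)

  x⁻¹*[x*y]≈y : ∀ {x} y → ¬ x ≈ 0# → x ⁻¹ * (x * y) ≈ y
  x⁻¹*[x*y]≈y {x} y x≉0 = begin-equality
    x ⁻¹ * (x * y)  ≈⟨ *-assoc (x ⁻¹) x y ⟨
    x ⁻¹ * x * y    ≈⟨ *-congʳ (≈.trans (*-comm (x ⁻¹) x) (⁻¹-inverse x≉0)) ⟩
    1# * y          ≈⟨ *-identityˡ y ⟩
    y               ∎

  *-cancelˡ-≤ : ∀ {z x y} → 0# < z → z * x ≤ z * y → x ≤ y
  *-cancelˡ-≤ {z} {x} {y} 0<z zx≤zy = begin
    x               ≈⟨ x⁻¹*[x*y]≈y x (0<x⇒x≉0 0<z) ⟨
    z ⁻¹ * (z * x)  ≤⟨ *-monoˡ-≤ (proj₁ (⁻¹-pos 0<z)) zx≤zy ⟩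
    z ⁻¹ * (z * y)  ≈⟨ x⁻¹*[x*y]≈y y (0<x⇒x≉0 0<z) ⟩
    y               ∎

  *-pos : ∀ {x y} → 0# < x → 0# < y → 0# < x * y
  *-pos {x} {y} 0<x 0<y = ≰⇒> λ xy≤0 → <⇒≱ 0<y
    (*-cancelˡ-≤ 0<x (≤-trans xy≤0 (≤-reflexive (≈.sym (zeroʳ x)))))

  +-pos : ∀ {x y} → 0# < x → 0# ≤ y → 0# < x + y
  +-pos {x} 0<x 0≤y = <-≤-trans 0<x (x≤x+y x 0≤y)

  ^-pos : ∀ {x} n → 0# < x → 0# < x ^ n
  ^-pos zero    0<x = 0<1
  ^-pos (suc n) 0<x = *-pos 0<x (^-pos n 0<x)

  -- The approximation parameters and the radii belonging to a separation `L`.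

  module Scales {ε : Carrier} (0<ε : 0# < ε) where

    1+ε ε′ base : Carrier
    1+ε  = 1# + ε
    ε′   = ε * 1+ε ⁻¹
    base = (4 · 1#) * ε′ ⁻¹

    0<1+ε : 0# < 1+ε
    0<1+ε = +-pos 0<1 (proj₁ 0<ε)

    0<ε′ : 0# < ε′
    0<ε′ = *-pos 0<ε (⁻¹-pos 0<1+ε)

    0<base : 0# < base
    0<base = *-pos (+-pos 0<1 (0≤n·1 3)) (⁻¹-pos 0<ε′)

    base*ε′≈4 : base * ε′ ≈ 4 · 1#
    base*ε′≈4 = begin-equality
      (4 · 1#) * ε′ ⁻¹ * ε′    ≈⟨ *-assoc (4 · 1#) (ε′ ⁻¹) ε′ ⟩
      (4 · 1#) * (ε′ ⁻¹ * ε′)  ≈⟨ *-congˡ (≈.trans (*-comm (ε′ ⁻¹) ε′) (⁻¹-inverse (0<x⇒x≉0 0<ε′))) ⟩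
      (4 · 1#) * 1#            ≈⟨ *-identityʳ (4 · 1#) ⟩
      4 · 1#                   ∎

    -- The reason for the choice of `ε′`: the fraction of `L` that replacements may lose and the
    -- fraction that has to remain make up the whole.
    ε′+[1+ε]⁻¹≈1 : ε′ + 1+ε ⁻¹ ≈ 1#
    ε′+[1+ε]⁻¹≈1 = begin-equality
      ε * 1+ε ⁻¹ + 1+ε ⁻¹       ≈⟨ +-congˡ (*-identityˡ (1+ε ⁻¹)) ⟨
      ε * 1+ε ⁻¹ + 1# * 1+ε ⁻¹  ≈⟨ distribʳ (1+ε ⁻¹) ε 1# ⟨
      (ε + 1#) * 1+ε ⁻¹         ≈⟨ *-congʳ (+-comm ε 1#) ⟩
      1+ε * 1+ε ⁻¹              ≈⟨ ⁻¹-inverse (0<x⇒x≉0 0<1+ε) ⟩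
      1#                        ∎

    module _ {L : Carrier} (0<L : 0# < L) where

      ρ M : Carrier
      ρ = L * base ⁻¹
      M = L * 1+ε ⁻¹

      0<ρ : 0# < ρ
      0<ρ = *-pos 0<L (⁻¹-pos 0<base)

      0<M : 0# < M
      0<M = *-pos 0<L (⁻¹-pos 0<1+ε)

      base*ρ≈L : base * ρ ≈ L
      base*ρ≈L = begin-equality
        base * (L * base ⁻¹)  ≈⟨ *-congˡ (*-comm L (base ⁻¹)) ⟩
        base * (base ⁻¹ * L)  ≈⟨ *-assoc base (base ⁻¹) L ⟨
        base * base ⁻¹ * L    ≈⟨ *-congʳ (⁻¹-inverse (0<x⇒x≉0 0<base)) ⟩
        1# * L                ≈⟨ *-identityˡ L ⟩
        L                     ∎

      -- The ratio of the two radii in the covering argument is the same for every `L`, so one size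
      -- of GMM output serves all separations.
      L*ρ⁻¹≈base : L * ρ ⁻¹ ≈ base
      L*ρ⁻¹≈base = begin-equality
        L * ρ ⁻¹            ≈⟨ *-congʳ base*ρ≈L ⟨
        base * ρ * ρ ⁻¹     ≈⟨ *-assoc base ρ (ρ ⁻¹) ⟩
        base * (ρ * ρ ⁻¹)   ≈⟨ *-congˡ (⁻¹-inverse (0<x⇒x≉0 0<ρ)) ⟩
        base * 1#           ≈⟨ *-identityʳ base ⟩
        base                ∎

      4ρ≈L*ε′ : (ρ + ρ) + (ρ + ρ) ≈ L * ε′
      4ρ≈L*ε′ = begin-equality
        (ρ + ρ) + (ρ + ρ)               ≈⟨ +-assoc ρ ρ (ρ + ρ) ⟩
        ρ + (ρ + (ρ + ρ))               ≈⟨ +-congˡ (+-congˡ (+-congˡ (+-identityʳ ρ))) ⟨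
        4 · ρ                           ≈⟨ ×-congʳ′ ⟨
        (4 · 1#) * ρ                    ≈⟨ *-congʳ base*ε′≈4 ⟨
        base * ε′ * ρ                   ≈⟨ *-congʳ (*-comm base ε′) ⟩
        ε′ * base * ρ                   ≈⟨ *-assoc ε′ base ρ ⟩
        ε′ * (base * ρ)                 ≈⟨ *-congˡ base*ρ≈L ⟩
        ε′ * L                          ≈⟨ *-comm ε′ L ⟩
        L * ε′                          ∎
        where
        ×-congʳ′ : (4 · 1#) * ρ ≈ 4 · ρ
        ×-congʳ′ = ≈.trans (Mult.×-assoc-* semiring 4 1# ρ) (Mult.×-congʳ semiring 4 (*-identityˡ ρ))

      -- The budget of a replacement: each end of a distance `L` may move by `2ρ`, and `M` is what
      -- is left.
      4ρ+M≈L : (ρ + ρ) + (ρ + ρ) + M ≈ L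
      4ρ+M≈L = begin-equality
        (ρ + ρ) + (ρ + ρ) + M  ≈⟨ +-congʳ 4ρ≈L*ε′ ⟩
        L * ε′ + L * 1+ε ⁻¹    ≈⟨ distribˡ L ε′ (1+ε ⁻¹) ⟨
        L * (ε′ + 1+ε ⁻¹)      ≈⟨ *-congˡ ε′+[1+ε]⁻¹≈1 ⟩
        L * 1#                 ≈⟨ *-identityʳ L ⟩
        L                      ∎

      0≤2ρ : 0# ≤ ρ + ρ
      0≤2ρ = proj₁ (+-pos 0<ρ (proj₁ 0<ρ))

      -- This is the condition on radii under which `Doubling` may be applied to `L` and `ρ`.
      2ρ≤L : ρ + ρ ≤ L
      2ρ≤L = begin
        ρ + ρ                  ≤⟨ x≤x+y (ρ + ρ) 0≤2ρ ⟩
        (ρ + ρ) + (ρ + ρ)      ≤⟨ x≤x+y _ (proj₁ 0<M) ⟩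
        (ρ + ρ) + (ρ + ρ) + M  ≈⟨ 4ρ+M≈L ⟩
        L                      ∎

      -- Lets fresh points, which keep distance `L` from the others, join an `M`-separated list.
      M≤L : M ≤ L
      M≤L = begin
        M                      ≤⟨ x≤x+y M (≤-trans 0≤2ρ (x≤x+y _ 0≤2ρ)) ⟩
        M + ((ρ + ρ) + (ρ + ρ)) ≈⟨ +-comm M _ ⟩
        (ρ + ρ) + (ρ + ρ) + M  ≈⟨ 4ρ+M≈L ⟩
        L                      ∎

-- What GMM selects, and the coreset made of its outputs.

module GMM {c ℓ₁ ℓ₂} (F : ArchimedeanOrderedField c ℓ₁ ℓ₂) {m : ℕ}
  (I : FairDiversification.Instance F m) where

  open FairDiversification F
  open ArchimedeanOrderedField F hiding (refl; sym; trans)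
  open OrderedField F
  open Instance I
  open IsGeneralMetric isMetric using (≈⇒0)

  extractFarthest-↭ : ∀ z ws → let (b , rest) = value (extractFarthest I z ws) in
                      b ∷ rest ↭ z ∷ ws
  extractFarthest-↭ z []       = ↭-refl
  extractFarthest-↭ z (w ∷ ws) with value (extractFarthest I w ws) | extractFarthest-↭ w ws
  ... | b , rest | ih with does (proj₂ b ≤? proj₂ z)
  ...   | true  = prep z ih
  ...   | false = ↭-trans (swap b z ↭-refl) (prep z ih)

  extractFarthest-max : ∀ z ws → let (b , rest) = value (extractFarthest I z ws) in
                        All (λ w → proj₂ w ≤ proj₂ b) rest
  extractFarthest-max z []       = []
  extractFarthest-max z (w ∷ ws) with value (extractFarthest I w ws) | extractFarthest-max w ws
  ... | b , rest | ih with proj₂ b ≤? proj₂ z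
  ...   | yes b≤z = b≤z ∷ All.map (λ w≤b → ≤-trans w≤b b≤z) ih
  ...   | no  b≰z = ≰⇒≥ b≰z ∷ ih

  retag-points : ∀ y zs → map proj₁ (value (retag I y zs)) ≡ map proj₁ zs
  retag-points y []             = refl
  retag-points y ((x , _) ∷ zs) = cong (x ∷_) (retag-points y zs)

  tag-points : ∀ y xs → map proj₁ (value (tag I y xs)) ≡ xs
  tag-points y []       = refl
  tag-points y (x ∷ xs) = cong (x ∷_) (tag-points y xs)

  extend-⊆ : ∀ s zs → value (extend I s zs) ⊆ map proj₁ zs
  extend-⊆ (suc s) (z ∷ zs) v∈ with value (extractFarthest I z zs) | extractFarthest-↭ z zs
  ... | (y , _) , rest | p = ∈-resp-↭ (↭.map⁺ proj₁ p) (go v∈)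
    where
    go : y ∷ value (extend I s (value (retag I y rest))) ⊆ y ∷ map proj₁ rest
    go (here eq)  = here eq
    go (there v∈) = there (subst (_ ∈_) (retag-points y rest) (extend-⊆ s (value (retag I y rest)) v∈))

  extend-unique : ∀ s zs → Unique (map proj₁ zs) → Unique (value (extend I s zs))
  extend-unique zero    zs       _   = []
  extend-unique (suc s) []       _   = []
  extend-unique (suc s) (z ∷ zs) zs! with value (extractFarthest I z zs) | extractFarthest-↭ z zs
  ... | (y , _) , rest | p with Unique-resp-↭ (↭-sym (↭.map⁺ proj₁ p)) zs!
  ... | y∉rest ∷ rest! =
    All.tabulate (λ v∈ → All.lookup y∉rest
      (subst (_ ∈_) (retag-points y rest) (extend-⊆ s (value (retag I y rest)) v∈))) ∷
    extend-unique s _ (subst Unique (sym (retag-points y rest)) rest!)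

  gmm-⊆ : ∀ xs s → value (gmm I xs s) ⊆ xs
  gmm-⊆ (x ∷ xs) (suc s) (here eq)  = here eq
  gmm-⊆ (x ∷ xs) (suc s) (there v∈) =
    there (subst (_ ∈_) (tag-points x xs) (extend-⊆ s (value (tag I x xs)) v∈))

  gmm-unique : ∀ xs s → Unique xs → Unique (value (gmm I xs s))
  gmm-unique xs       zero    _            = []
  gmm-unique []       (suc s) _            = []
  gmm-unique (x ∷ xs) (suc s) (x∉xs ∷ xs!) =
    All.tabulate (λ v∈ → All.lookup x∉xs
      (subst (_ ∈_) (tag-points x xs) (extend-⊆ s (value (tag I x xs)) v∈))) ∷
    extend-unique s _ (subst Unique (sym (tag-points x xs)) xs!)

  -- The tag is the distance from `Y`, encoded as a lower bound that some point of `Y` reaches. This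
  -- avoids a minimum over lists, and the second component rules out an empty `Y`.
  IsDistanceTo : List Point → Tagged I → Set _
  IsDistanceTo Y (x , δ) = All (λ y → δ ≤ d y x) Y × Any (λ y → d y x ≤ δ) Y

  tag-distance : ∀ y xs → All (IsDistanceTo (y ∷ [])) (value (tag I y xs))
  tag-distance y []       = []
  tag-distance y (x ∷ xs) = (≤-refl ∷ [] , here ≤-refl) ∷ tag-distance y xs

  retag-distance : ∀ y {Y zs} → All (IsDistanceTo Y) zs →
                   All (IsDistanceTo (y ∷ Y)) (value (retag I y zs))
  retag-distance y {zs = []}           []               = []
  retag-distance y {zs = (x , δ) ∷ zs} ((lb , att) ∷ h) with d y x ≤? δ
  ... | yes δ′≤δ = (≤-refl ∷ All.map (≤-trans δ′≤δ) lb , here ≤-refl) ∷ retag-distance y h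
  ... | no  δ′≰δ = (≰⇒≥ δ′≰δ ∷ lb , there att) ∷ retag-distance y h

  Near : Carrier → Point → Point → Set _
  Near b x y = d y x ≤ b

  d-refl : ∀ {b} x → 0# ≤ b → d x x ≤ b
  d-refl x 0≤b = ≤-trans (≤-reflexive (≈⇒0 refl)) 0≤b

  -- `Y` holds the points selected earlier. Either the largest tag is at most `b` and all remaining
  -- points are near `Y`, or the extracted point is farther than `b` from `Y` and the induction goes
  -- on with that point added to `Y`.
  extend-dichotomy : ∀ {b} → 0# ≤ b → ∀ s zs Y → All (IsDistanceTo Y) zs →
    let ys = value (extend I s zs) in
    All (λ x → Any (Near b x) Y ⊎ Any (Near b x) ys) (map proj₁ zs) ⊎
    (s ℕ.≤ length ys × All (λ y → All (λ y′ → b < d y′ y) Y) ys ×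
     AllPairs (λ y y′ → b < d y y′) ys)
  extend-dichotomy 0≤b zero    zs       Y h = inj₂ (z≤n , [] , [])
  extend-dichotomy 0≤b (suc s) []       Y h = inj₁ []
  extend-dichotomy {b} 0≤b (suc s) (z ∷ zs) Y h
    with value (extractFarthest I z zs) | extractFarthest-↭ z zs | extractFarthest-max z zs
  ... | (y , δ) , rest | perm | max
    with All-resp-↭ (↭-sym perm) h
  ... | (lb , att) ∷ h′
    with δ ≤? b
  -- `y` carries the largest tag, so every other tag is at most `b` as well.
  ... | yes δ≤b = inj₁ (All.map inj₁ 
    (All-resp-↭ {P = λ x → Any (Near b x) Y} (↭.map⁺ proj₁ perm) (near att δ≤b ∷ All.map⁺ near-rest)))
    where
    near : ∀ {x δ′} → Any (λ y → d y x ≤ δ′) Y → δ′ ≤ b → Any (Near b x) Y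
    near att δ′≤b = Any.map (λ le → ≤-trans le δ′≤b) att
    near-rest : All (λ w → Any (Near b (proj₁ w)) Y) rest
    near-rest = All.zipWith (λ ((_ , att′) , δ′≤δ) → near att′ (≤-trans δ′≤δ δ≤b)) (h′ , max)
  ... | no δ≰b with extend-dichotomy 0≤b s (value (retag I y rest)) (y ∷ Y) (retag-distance y h′)
  ...   | inj₂ (s≤ , far , sep) = inj₂
          ( s≤s s≤
          , All.map (<-≤-trans (≰⇒> δ≰b)) lb ∷ All.map All.tail far
          , All.map All.head far ∷ sep)
  ...   | inj₁ covered = inj₁ (All-resp-↭ (↭.map⁺ proj₁ perm)
          (inj₂ (here (d-refl y 0≤b)) ∷ All.map reassoc (subst (All _) (retag-points y rest) covered)))
    where
    -- The recursive call counts `y` among the earlier points, whereas here it is the first point of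
    -- the output.
    reassoc : ∀ {x} → Any (Near b x) (y ∷ Y) ⊎ Any (Near b x) _ → Any (Near b x) Y ⊎ Any (Near b x) _
    reassoc (inj₁ (here near))  = inj₂ (here near)
    reassoc (inj₁ (there near)) = inj₁ near
    reassoc (inj₂ near)         = inj₂ (there near)

  -- The first selected point takes the place of `Y` in `extend-dichotomy`. With `b` equal to
  -- `ρ + ρ` this tells the groups where points are replaced from those where fresh points are
  -- found.
  gmm-dichotomy : ∀ {b} → 0# ≤ b → ∀ xs s → let ys = value (gmm I xs s) in
    All (λ x → Any (Near b x) ys) xs ⊎ (s ℕ.≤ length ys × AllPairs (λ y y′ → b < d y y′) ys)
  gmm-dichotomy 0≤b xs       zero    = inj₂ (z≤n , [])
  gmm-dichotomy 0≤b []       (suc s) = inj₁ []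
  gmm-dichotomy 0≤b (x ∷ xs) (suc s)
    with extend-dichotomy 0≤b s (value (tag I x xs)) (x ∷ []) (tag-distance x xs)
  ... | inj₁ covered = inj₁ (here (d-refl x 0≤b) ∷
          All.map (λ { (inj₁ (here near)) → here near ; (inj₂ near) → there near })
                  (subst (All _) (tag-points x xs) covered))
  ... | inj₂ (s≤ , far , sep) = inj₂ (s≤s s≤ , All.map All.head far ∷ sep)

  members : Fin m → List Point
  members i = value (membersᵗ I i (allFin n))

  membersᵗ-value : ∀ i xs → value (membersᵗ I i xs) ≡ filter (λ x → group x ≟ i) xs
  membersᵗ-value i []       = refl
  membersᵗ-value i (x ∷ xs) with does (group x ≟ i)
  ... | true  = cong (x ∷_) (membersᵗ-value i xs)
  ... | false = membersᵗ-value i xs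

  ∈-members⁺ : ∀ x → x ∈ members (group x)
  ∈-members⁺ x = subst (x ∈_) (sym (membersᵗ-value (group x) (allFin n)))
    (∈-filter⁺ (λ y → group y ≟ group x) (∈-allFin x) refl)

  ∈-members⁻ : ∀ {i x} → x ∈ members i → group x ≡ i
  ∈-members⁻ {i} {x} x∈ = proj₂ (∈-filter⁻ (λ y → group y ≟ i) {xs = allFin n}
    (subst (x ∈_) (membersᵗ-value i (allFin n)) x∈))

  members-unique : ∀ i → Unique (members i)
  members-unique i = subst Unique (sym (membersᵗ-value i (allFin n))) (Unique.filter⁺ _ (Unique.allFin⁺ n))

  part : ℕ → Fin m → List Point
  part s i = value (gmm I (members i) s)

  ∈-part⁻ : ∀ {s i x} → x ∈ part s i → group x ≡ i
  ∈-part⁻ {s} {i} x∈ = ∈-members⁻ (gmm-⊆ (members i) s x∈)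

  appendᵗ-value : ∀ {a} {A : Set a} (xs ys : List A) → value (appendᵗ I xs ys) ≡ xs ++ ys
  appendᵗ-value []       ys = refl
  appendᵗ-value (x ∷ xs) ys = cong (x ∷_) (appendᵗ-value xs ys)

  coreset-value : ∀ s is → value (coreset I s is) ≡ concatMap (part s) is
  coreset-value s []       = refl
  coreset-value s (i ∷ is) = trans (appendᵗ-value (part s i) _) (cong (part s i ++_) (coreset-value s is))

  Coreset : ℕ → List Point
  Coreset s = value (coreset I s (allFin m))

  part⊆Coreset : ∀ {s i x} → x ∈ part s i → x ∈ Coreset s
  part⊆Coreset {s} {i} x∈ = subst (_ ∈_) (sym (coreset-value s (allFin m)))
    (∈-concat⁺′ x∈ (∈-map⁺ (part s) (∈-allFin i)))

  -- A point determines its group, so the lists of two different groups are disjoint.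
  groupwise-unique : (f : Fin m → List Point) → (∀ i → Unique (f i)) → (∀ {i x} → x ∈ f i → group x ≡ i) →
                     Unique (concatMap f (allFin m))
  groupwise-unique f f! f⁻ = Unique.concat⁺
    (All.map⁺ (All.universal f! (allFin m)))
    (AllPairs.map⁺ (AllPairs.map (λ i≢j {_} (x∈i , x∈j) → i≢j (trans (sym (f⁻ x∈i)) (f⁻ x∈j))) (Unique.allFin⁺ m)))

  Coreset-unique : ∀ s → Unique (Coreset s)
  Coreset-unique s = subst Unique (sym (coreset-value s (allFin m)))
    (groupwise-unique (part s) (λ i → gmm-unique (members i) s (members-unique i)) (∈-part⁻ {s}))

-- Moving a fair set into the coreset.

module Selection {c ℓ₁ ℓ₂} (F : ArchimedeanOrderedField c ℓ₁ ℓ₂) {m : ℕ}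
  (I : FairDiversification.Instance F m) where

  open FairDiversification F
  open ArchimedeanOrderedField F hiding (refl; sym; trans)
  open OrderedField F
  open Instance I
  open IsGeneralMetric isMetric using (triangle) renaming (sym to d-sym)
  private module ≈ = ArchimedeanOrderedField F
  open GMM F I
  open ≤-Reasoning

  Separated : Carrier → List Point → Set _
  Separated L = AllPairs (λ x y → L ≤ d x y)

  swap-≤ : ∀ {L x y} → L ≤ d x y → L ≤ d y x
  swap-≤ {x = x} {y} = ≤-respʳ-≈ (d-sym x y)

  -- Counting on the list of groups instead of the list of points lets fairness pass along a
  -- permutation of groups while the points themselves are exchanged.
  tally : Fin m → List (Fin m) → ℕ
  tally i gs = length (filter (_≟ i) gs)

  tally-map-group : ∀ i xs → tally i (map group xs) ≡ length (filter (λ x → group x ≟ i) xs)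
  tally-map-group i []       = refl
  tally-map-group i (x ∷ xs) with does (group x ≟ i)
  ... | true  = cong suc (tally-map-group i xs)
  ... | false = tally-map-group i xs

  -- Cutting each group down to `k i` points gives a list of `kTotal` points in all, so fewer than
  -- `kTotal` are chosen whenever one is still to be added.
  block : Subset n → Fin m → List Point
  block S i = take (k i) (elements (S ∩ X i))

  fairList : Subset n → List Point
  fairList S = concatMap (block S) (allFin m)

  ∈-X⁻ : ∀ {i x} → x Subset.∈ X i → group x ≡ i
  ∈-X⁻ {i} {x} x∈X with group x ≟ i | Vec.lookup∘tabulate (λ y → does (group y ≟ i)) x
  ... | yes eq | _   = eq
  ... | no  _  | eq′ = contradiction (trans (sym eq′) (Vec.[]=⇒lookup x∈X)) λ ()

  ∈-X⁺ : ∀ x → x Subset.∈ X (group x)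
  ∈-X⁺ x with group x ≟ group x | Vec.lookup∘tabulate (λ y → does (group y ≟ group x)) x
  ... | yes _ | eq′ = Vec.lookup⇒[]= x (X (group x)) eq′
  ... | no ¬r | _   = contradiction refl ¬r

  ∈-take⁻ : ∀ {a} {A : Set a} {x : A} j xs → x ∈ take j xs → x ∈ xs
  ∈-take⁻ j xs x∈ = subst (_ ∈_) (take++drop≡id j xs) (∈-++⁺ˡ x∈)

  ∈-block⁻ : ∀ {S i x} → x ∈ block S i → x Subset.∈ S × group x ≡ i
  ∈-block⁻ {S} {i} x∈ with x∈p∩q⁻ S (X i) (∈-elements⁻ (S ∩ X i) (∈-take⁻ (k i) _ x∈))
  ... | x∈S , x∈X = x∈S , ∈-X⁻ x∈X

  module _ {S : Subset n} (fair : Fair I S) where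

    length-block : ∀ i → length (block S i) ≡ k i
    length-block i = trans (length-take (k i) (elements (S ∩ X i)))
      (ℕ.m≤n⇒m⊓n≡m (subst (k i ℕ.≤_) (sym (length-elements (S ∩ X i))) (fair i)))

    length-fairList : length (fairList S) ≡ kTotal
    length-fairList = go (allFin m)
      where
      go : ∀ is → length (concatMap (block S) is) ≡ sum (map k is)
      go []       = refl
      go (i ∷ is) = trans (length-++ (block S i)) (cong₂ ℕ._+_ (length-block i) (go is))

    fairList-unique : Unique (fairList S)
    fairList-unique = groupwise-unique (block S)
      (λ i → Unique.take⁺ (k i) (elements-unique (S ∩ X i))) (λ {i} → proj₂ ∘ ∈-block⁻ {S} {i})

    fairList-⊆ : ∀ {x} → x ∈ fairList S → x Subset.∈ S
    fairList-⊆ x∈ with find (∈-concatMap⁻ (block S) {xs = allFin m} x∈)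
    ... | i , _ , x∈i = proj₁ (∈-block⁻ {S} {i} x∈i)

    k≤tally : ∀ i → k i ℕ.≤ tally i (map group (fairList S))
    k≤tally i = subst₂ ℕ._≤_ (length-block i) (sym (tally-map-group i (fairList S)))
      (unique-⊆⇒length≤ (Unique.take⁺ (k i) (elements-unique (S ∩ X i))) λ x∈ →
        ∈-filter⁺ (λ x → group x ≟ i) (∈-concat⁺′ x∈ (∈-map⁺ (block S) (∈-allFin i)))
                  (proj₂ (∈-block⁻ {S} {i} x∈)))

  module _ {ε : Carrier} (0<ε : 0# < ε) {dim : ℕ} (doubling : Doubling I dim) {s : ℕ}
           (large : Scales.base 0<ε ^ dim * (kTotal · 1#) ≤ s · 1#) {L : Carrier} (0<L : 0# < L) where

    open Scales 0<ε hiding (ρ; M)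

    private
      ρ M : Carrier
      ρ = Scales.ρ 0<ε 0<L
      M = Scales.M 0<ε 0<L

    -- Concatenates one doubling cover for each `u`. Each contributes at most `base ^ dim` balls,
    -- because the ratio of `L` to `ρ` is `base`.
    cover : ∀ us → ∃ λ cs → length cs · 1# ≤ base ^ dim * (length us · 1#) ×
            (∀ q → Any (λ u → d u q < L) us → Any (λ o → d o q < ρ) cs)
    cover []       = [] , ≤-reflexive (≈.sym (zeroʳ _)) , λ _ ()
    cover (u ∷ us) with doubling u L ρ (0<ρ 0<L) (2ρ≤L 0<L) | cover us
    ... | cs , few , cov | cs′ , few′ , cov′ = cs ++ cs′ , few″ , cov″
      where
      few″ : length (cs ++ cs′) · 1# ≤ base ^ dim * (1# + length us · 1#)
      few″ = begin
        length (cs ++ cs′) · 1#  ≡⟨ cong (_· 1#) (length-++ cs) ⟩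
        (length cs ℕ.+ length cs′) · 1#  ≈⟨ ×-homo-+ 1# (length cs) (length cs′) ⟩
        length cs · 1# + length cs′ · 1#  ≤⟨ +-mono-≤ few few′ ⟩
        (L * ρ ⁻¹) ^ dim + base ^ dim * (length us · 1#) ≈⟨ +-congʳ (^-congˡ dim (L*ρ⁻¹≈base 0<L)) ⟩
        base ^ dim + base ^ dim * (length us · 1#) ≈⟨ +-congʳ (*-identityʳ _) ⟨
        base ^ dim * 1# + base ^ dim * (length us · 1#) ≈⟨ distribˡ _ _ _ ⟨
        base ^ dim * (1# + length us · 1#) ∎
      cov″ : ∀ q → Any (λ u → d u q < L) (u ∷ us) → Any (λ o → d o q < ρ) (cs ++ cs′)
      cov″ q (here near) with cov q near
      ... | o , o∈cs , o~q = Any.++⁺ˡ (lose o∈cs o~q)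
      cov″ q (there near) = Any.++⁺ʳ cs (cov′ q near)

    -- If no point of `T` is far from `us`, then `base ^ dim * k` is at most `s`, hence at most the
    -- size of `T`, hence at most the number of covering balls, hence at most `base ^ dim` times the
    -- length of `us`. Cancelling the positive power contradicts the bound on that length.
    pick-far : ∀ {T} → s ℕ.≤ length T → AllPairs (λ t t′ → ρ + ρ < d t t′) T →
               ∀ {us} → length us ℕ.< kTotal → ∃ λ t → t ∈ T × All (λ u → L ≤ d t u) us
    pick-far {T} s≤ sep {us} |us|<k with Any.any? (λ t → All.all? (λ u → L ≤? d u t) us) T
    ... | yes found = let t , t∈T , far = find found in t , t∈T , All.map swap-≤ far
    ... | no ¬found = contradiction
      (ℕ.≤-trans |us|<k (·1-cancel-≤ _ _ (*-cancelˡ-≤ (^-pos dim 0<base) k≤us))) (ℕ.n≮n _)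
      where
      crowded : All (λ t → Any (λ u → d u t < L) us) T
      crowded = All.map (λ {t} ¬far → Any.map ≰⇒> (All.¬All⇒Any¬ (λ u → L ≤? d u t) us ¬far))
        (All.¬Any⇒All¬ T ¬found)
      cs = cover us
      T≤cs : length T ℕ.≤ length (proj₁ cs)
      T≤cs = pigeonhole (All.map (λ {t} → proj₂ (proj₂ cs) t) crowded)
        -- Two points of `T` in a common ball around `o` would be at distance at most `ρ + ρ`.
        (AllPairs.map (λ {t} {t′} 2ρ<d o (ot≤ , _) (ot′≤ , _) → <⇒≱ 2ρ<d
          (≤-trans (triangle t o t′) (+-mono-≤ (≤-respˡ-≈ (d-sym o t) ot≤) ot′≤))) sep)
      k≤us : base ^ dim * (kTotal · 1#) ≤ base ^ dim * (length us · 1#)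
      k≤us = begin
        base ^ dim * (kTotal · 1#)  ≤⟨ large ⟩
        s · 1#                      ≤⟨ ·1-mono-≤ (ℕ.≤-trans s≤ T≤cs) ⟩
        length (proj₁ cs) · 1#      ≤⟨ proj₁ (proj₂ cs) ⟩
        base ^ dim * (length us · 1#) ∎

    -- Both are properties of a point of the fair set, although the second depends on its group
    -- alone, so that `separate` can split the list of points by them.
    Replaceable Extendable : Point → Set _
    Replaceable o = ∃ λ t → t ∈ part s (group o) × d t o ≤ ρ + ρ
    Extendable o = s ℕ.≤ length (part s (group o)) × AllPairs (λ t t′ → ρ + ρ < d t t′) (part s (group o))

    classify : ∀ o → Replaceable o ⊎ Extendable o
    classify o with gmm-dichotomy (0≤2ρ 0<L) (members (group o)) s
    ... | inj₁ covered = inj₁ (find (All.lookup covered (∈-members⁺ o)))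
    ... | inj₂ sep     = inj₂ sep

    Selected : Point → Set _
    Selected u = u ∈ part s (group u)

    -- The path from `o` over `t` and `u` to `o′` exceeds `d t u` by at most `4ρ`, and `L` minus
    -- `4ρ` is `M`.
    replace-separated : ∀ {t o us os} → d t o ≤ ρ + ρ → Pointwise (λ u o → d u o ≤ ρ + ρ) us os →
                        All (λ o′ → L ≤ d o o′) os → All (λ u → M ≤ d t u) us
    replace-separated t~o []            []         = []
    replace-separated {t} {o} {u ∷ _} {o′ ∷ _} t~o (u~o′ ∷ us~) (far ∷ fars) =
      M≤d ∷ replace-separated t~o us~ fars
      where
      M≤d : M ≤ d t u
      M≤d = +-cancelˡ-≤ ((ρ + ρ) + (ρ + ρ)) (begin
        (ρ + ρ) + (ρ + ρ) + M        ≈⟨ 4ρ+M≈L 0<L ⟩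
        L                                 ≤⟨ far ⟩
        d o o′                            ≤⟨ triangle o t o′ ⟩
        d o t + d t o′                    ≤⟨ +-mono-≤ (≤-respˡ-≈ (d-sym t o) t~o) (triangle t u o′) ⟩
        (ρ + ρ) + (d t u + d u o′)      ≤⟨ +-monoʳ-≤ _ (+-monoʳ-≤ _ u~o′) ⟩
        (ρ + ρ) + (d t u + (ρ + ρ))   ≈⟨ +-congˡ (+-comm _ _) ⟩
        (ρ + ρ) + ((ρ + ρ) + d t u)   ≈⟨ +-assoc _ _ _ ⟨
        (ρ + ρ) + (ρ + ρ) + d t u     ∎)

    -- The pointwise closeness is part of the result for the sake of the induction: a new
    -- replacement is compared with later ones through the points that those replace.
    replace : ∀ {os} → All Replaceable os → Separated L os →
              ∃ λ us → map group us ≡ map group os × All Selected us × Separated M us ×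
                       Pointwise (λ u o → d u o ≤ ρ + ρ) us os
    replace []                       []         = [] , refl , [] , [] , []
    replace ((t , t∈ , t~o) ∷ rs) (far ∷ sep) with replace rs sep | ∈-part⁻ {s} t∈
    ... | us , eq , sel , sep′ , us~os | gt≡go =
      t ∷ us , cong₂ _∷_ gt≡go eq , subst (λ g → t ∈ part s g) (sym gt≡go) t∈ ∷ sel ,
      replace-separated t~o us~os far ∷ sep′ , t~o ∷ us~os

    -- Fresh points are taken one at a time from the part of the group concerned, but far from all
    -- points chosen so far, whatever their groups. The bound on the total length keeps `pick-far`
    -- applicable.
    add : ∀ {os us} → All Extendable os → All Selected us → Separated M us →
          length os ℕ.+ length us ℕ.≤ kTotal →
          ∃ λ vs → map group vs ≡ map group os ++ map group us × All Selected vs × Separated M vs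
    add []                          sel sep _    = _ , refl , sel , sep
    add {o ∷ os} {us} ((s≤ , spread) ∷ es) sel sep 1+≤k with add es sel sep (ℕ.<⇒≤ 1+≤k)
    ... | vs , eq , sel′ , sep′ with pick-far s≤ spread (subst (ℕ._< kTotal) (sym |vs|) 1+≤k)
      where
      |vs| : length vs ≡ length os ℕ.+ length us
      |vs| = trans (sym (length-map group vs)) (trans (cong length eq)
        (trans (length-++ (map group os)) (cong₂ ℕ._+_ (length-map group os) (length-map group us))))
    ... | t , t∈ , far with ∈-part⁻ {s} t∈
    ... | gt≡go = t ∷ vs , cong₂ _∷_ gt≡go eq , subst (λ g → t ∈ part s g) (sym gt≡go) t∈ ∷ sel′ ,
                  All.map (≤-trans (M≤L 0<L)) far ∷ sep′

    -- Replacements come first, since they depend on the old distances only; the fresh points are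
    -- then fitted around them. Splitting the list reorders it, hence the permutation.
    select : ∀ {os} → length os ≡ kTotal → Separated L os →
             ∃ λ us → map group us ↭ map group os × All Selected us × Separated M us
    select {os} |os| sep with separate classify sep
    ... | ds , es , os↭ , rs , xs , ds-sep with replace rs ds-sep
    ... | us , eq , sel , us-sep , _ with add xs sel us-sep (ℕ.≤-reflexive |es|+|us|)
      where
      |es|+|us| : length es ℕ.+ length us ≡ kTotal
      |es|+|us| = trans (cong (length es ℕ.+_)
          (trans (sym (length-map group us)) (trans (cong length eq) (length-map group ds))))
        (trans (ℕ.+-comm (length es) (length ds)) (trans (sym (length-++ ds)) (trans (sym (↭-length os↭)) |os|)))
    ... | vs , eq′ , sel′ , vs-sep = vs , perm , sel′ , vs-sep
      where
      perm : map group vs ↭ map group os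
      perm = ↭-trans (↭-reflexive (trans eq′ (trans (cong (map group es ++_) eq) (sym (map-++ group es ds)))))
        (↭.map⁺ group (↭-trans (↭.++-comm es ds) (↭-sym os↭)))

-- Diversity of lists, the enumeration and the approximation ratio.

module Correctness {c ℓ₁ ℓ₂} (F : ArchimedeanOrderedField c ℓ₁ ℓ₂) {m : ℕ}
  (I : FairDiversification.Instance F m) where

  open FairDiversification F
  open ArchimedeanOrderedField F hiding (refl; sym; trans)
  open OrderedField F
  open Instance I
  open IsGeneralMetric isMetric using (nonNegative; ≈⇒0; 0⇒≈) renaming (sym to d-sym)
  private module ≈ = ArchimedeanOrderedField F
  open GMM F I
  open Selection F I
  open AddSupremum _≤_ using (_≤⊤⁺; ≤⁺-dec; [≤]-injective) renaming ([_] to [_]⁺)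
  open TotalOrder extended using ()
    renaming (refl to ≤⁺-refl; trans to ≤⁺-trans; total to ≤⁺-total)
  open Data.List.Extrema extended using (min≤xs; v≤min⁺; argmin-sel; argmax-sel)
  private module Max = Data.List.Extrema totalOrder

  minᵗ-≤ˡ : ∀ x y → value (minᵗ I x y) ≤⁺ x
  minᵗ-≤ˡ x y with ≤⁺-dec _≤?_ x y
  ... | yes _   = ≤⁺-refl
  ... | no  x≰y with ≤⁺-total x y
  ...   | inj₁ x≤y = contradiction x≤y x≰y
  ...   | inj₂ y≤x = y≤x

  minᵗ-≤ʳ : ∀ x y → value (minᵗ I x y) ≤⁺ y
  minᵗ-≤ʳ x y with ≤⁺-dec _≤?_ x y
  ... | yes x≤y = x≤y
  ... | no  _   = ≤⁺-refl

  minᵗ-glb : ∀ {z} x y → z ≤⁺ x → z ≤⁺ y → z ≤⁺ value (minᵗ I x y)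
  minᵗ-glb x y z≤x z≤y with ≤⁺-dec _≤?_ x y
  ... | yes _ = z≤x
  ... | no  _ = z≤y

  nearestᵗ-lower : ∀ x ys → All (λ y → value (nearestᵗ I x ys) ≤⁺ [ d x y ]) ys
  nearestᵗ-lower x []       = []
  nearestᵗ-lower x (y ∷ ys) =
    minᵗ-≤ˡ _ (value (nearestᵗ I x ys)) ∷
    All.map (≤⁺-trans (minᵗ-≤ʳ [ d x y ] _)) (nearestᵗ-lower x ys)

  nearestᵗ-greatest : ∀ {z x ys} → All (λ y → z ≤⁺ [ d x y ]) ys → z ≤⁺ value (nearestᵗ I x ys)
  nearestᵗ-greatest []       = _ ≤⊤⁺
  nearestᵗ-greatest (h ∷ hs) = minᵗ-glb _ _ h (nearestᵗ-greatest hs)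

  divᵗ-lower : ∀ xs → AllPairs (λ x y → value (divᵗ I xs) ≤⁺ [ d x y ]) xs
  divᵗ-lower []       = []
  divᵗ-lower (x ∷ xs) =
    All.map (≤⁺-trans (minᵗ-≤ˡ _ (value (divᵗ I xs)))) (nearestᵗ-lower x xs) ∷
    AllPairs.map (≤⁺-trans (minᵗ-≤ʳ (value (nearestᵗ I x xs)) _)) (divᵗ-lower xs)

  divᵗ-greatest : ∀ {z xs} → AllPairs (λ x y → z ≤⁺ [ d x y ]) xs → z ≤⁺ value (divᵗ I xs)
  divᵗ-greatest []         = _ ≤⊤⁺
  divᵗ-greatest (hs ∷ hss) = minᵗ-glb _ _ (nearestᵗ-greatest hs) (divᵗ-greatest hss)

  distinctIn? : ∀ S (uv : Point × Point) →
                Dec (proj₁ uv Subset.∈ S × proj₂ uv Subset.∈ S × proj₁ uv ≢ proj₂ uv)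
  distinctIn? S (u , v) = (u ∈ˢ? S) ×-dec (v ∈ˢ? S) ×-dec ¬? (u ≟ v)

  div-lower : ∀ {S u v} → u Subset.∈ S → v Subset.∈ S → u ≢ v → div I S ≤⁺ [ d u v ]
  div-lower {S} {u} {v} u∈S v∈S u≢v = All.lookup (min≤xs _ _)
    (∈-map⁺ (λ (u , v) → [ d u v ])
      (∈-filter⁺ (distinctIn? S)
        (∈-cartesianProduct⁺ (∈-allFin u) (∈-allFin v)) (u∈S , v∈S , u≢v)))

  div-greatest : ∀ {z S} → (∀ {u v} → u Subset.∈ S → v Subset.∈ S → u ≢ v → z ≤⁺ [ d u v ]) → z ≤⁺ div I S
  div-greatest {z} {S} h = v≤min⁺ (_ ≤⊤⁺) (All.map⁺ (All.map (λ (u∈S , v∈S , u≢v) → h u∈S v∈S u≢v)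
    (All.all-filter (distinctIn? S) (cartesianProduct (allFin n) (allFin n)))))

  d-pos : ∀ {u v} → u ≢ v → 0# < d u v
  d-pos u≢v = nonNegative , λ 0≈d → u≢v (0⇒≈ (≈.sym 0≈d))

  -- A minimum is either its default, here `⊤⁺`, or one of the listed values, and these are
  -- distances of distinct points.
  div-pos : ∀ {S L} → div I S ≡ [ L ] → 0# < L
  div-pos {S} div≡L with argmin-sel id ⊤⁺ (map (λ (u , v) → [ d u v ])
      (filter (distinctIn? S) (cartesianProduct (allFin n) (allFin n))))
  ... | inj₁ div≡⊤ = contradiction (trans (sym div≡⊤) div≡L) λ ()
  ... | inj₂ div∈ with ∈-map⁻ _ div∈
  ... | (u , v) , uv∈ , div≡d
    with ∈-filter⁻ (distinctIn? S) {xs = cartesianProduct (allFin n) (allFin n)} uv∈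
       | trans (sym div≡d) div≡L
  ... | _ , _ , _ , u≢v | refl = d-pos u≢v

  div-nonNegative : ∀ {S} → [ 0# ] ≤⁺ div I S
  div-nonNegative = div-greatest λ _ _ _ → [ nonNegative ]⁺

  ∈-⟦⟧⁺ : ∀ {xs x} → x ∈ xs → x Subset.∈ ⟦_⟧ I xs
  ∈-⟦⟧⁺ (here refl) = x∈p∪q⁺ (inj₁ (x∈⁅x⁆ _))
  ∈-⟦⟧⁺ (there x∈)  = x∈p∪q⁺ (inj₂ (∈-⟦⟧⁺ x∈))

  ∈-⟦⟧⁻ : ∀ xs {x} → x Subset.∈ ⟦_⟧ I xs → x ∈ xs
  ∈-⟦⟧⁻ []       x∈ = contradiction x∈ ∉⊥
  ∈-⟦⟧⁻ (y ∷ xs) x∈ with x∈p∪q⁻ ⁅ y ⁆ (⟦_⟧ I xs) x∈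
  ... | inj₁ x∈y  = here (x∈⁅y⁆⇒x≡y y x∈y)
  ... | inj₂ x∈xs = there (∈-⟦⟧⁻ xs x∈xs)

  -- `divᵗ` looks at each pair in one order only; symmetry of `d` covers the other order.
  divᵗ≤div : ∀ xs → value (divᵗ I xs) ≤⁺ div I (⟦_⟧ I xs)
  divᵗ≤div xs = div-greatest λ {u} {v} u∈ v∈ u≢v →
    allPairs-lookup (λ {x} {y} le → ≤⁺-trans le [ ≤-reflexive (d-sym x y) ]⁺) (divᵗ-lower xs)
      (∈-⟦⟧⁻ xs u∈) (∈-⟦⟧⁻ xs v∈) u≢v

  count : Fin m → List Point → ℕ
  count i xs = value (countᵗ I i xs)

  count-filter : ∀ i xs → count i xs ≡ length (filter (λ x → group x ≟ i) xs)
  count-filter i []       = refl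
  count-filter i (x ∷ xs) with does (group x ≟ i)
  ... | true  = cong suc (count-filter i xs)
  ... | false = count-filter i xs

  FairList : List Point → Set
  FairList xs = ∀ i → k i ℕ.≤ count i xs

  fairList⇒fair : ∀ {xs} → Unique xs → FairList xs → Fair I (⟦_⟧ I xs)
  fairList⇒fair {xs} xs! fair i = ℕ.≤-trans (fair i)
    (subst₂ ℕ._≤_ (sym (count-filter i xs)) (length-elements (⟦_⟧ I xs ∩ X i))
    (unique-⊆⇒length≤ (Unique.filter⁺ (λ x → group x ≟ i) xs!) λ {x} x∈ →
      let x∈xs , gx≡i = ∈-filter⁻ (λ x → group x ≟ i) {xs = xs} x∈ in
      ∈-elements⁺ (x∈p∩q⁺ (∈-⟦⟧⁺ x∈xs , subst (λ j → x Subset.∈ X j) gx≡i (∈-X⁺ x)))))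

  fairᵗ-sound : ∀ {xs} is → value (fairᵗ I xs is) ≡ true → All (λ i → k i ℕ.≤ count i xs) is
  fairᵗ-sound []                _  = []
  fairᵗ-sound {xs} (i ∷ is) eq with k i ℕ.≤ᵇ count i xs in k≤ᵇ
  ... | true = ℕ.≤ᵇ⇒≤ (k i) _ (subst T (sym k≤ᵇ) tt) ∷ fairᵗ-sound {xs} is eq

  fairᵗ-complete : ∀ {xs is} → All (λ i → k i ℕ.≤ count i xs) is → value (fairᵗ I xs is) ≡ true
  fairᵗ-complete []                         = refl
  fairᵗ-complete {xs} {i ∷ is} (k≤ ∷ k≤s) with k i ℕ.≤ᵇ count i xs | ℕ.≤⇒≤ᵇ k≤
  ... | true | _ = fairᵗ-complete {xs} k≤s

  isFair : List Point → Bool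
  isFair xs = value (fairᵗ I xs (allFin m))

  consAllᵗ-value : ∀ x yss → value (consAllᵗ I x yss) ≡ map (x ∷_) yss
  consAllᵗ-value x []         = refl
  consAllᵗ-value x (ys ∷ yss) = cong ((x ∷ ys) ∷_) (consAllᵗ-value x yss)

  Sublists : List Point → List (List Point)
  Sublists xs = value (sublistsᵗ I xs)

  Sublists-∷ : ∀ x xs → Sublists (x ∷ xs) ≡ map (x ∷_) (Sublists xs) ++ Sublists xs
  Sublists-∷ x xs = trans (appendᵗ-value (value (consAllᵗ I x (Sublists xs))) (Sublists xs))
    (cong (_++ Sublists xs) (consAllᵗ-value x (Sublists xs)))

  -- The enumeration keeps the order of the coreset, so a set of coreset points is located in it by
  -- filtering.
  filter∈Sublists : ∀ {p} {P : Point → Set p} (P? : ∀ x → Dec (P x)) xs → filter P? xs ∈ Sublists xs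
  filter∈Sublists P? []       = here refl
  filter∈Sublists P? (x ∷ xs) rewrite Sublists-∷ x xs with does (P? x)
  ... | true  = ∈-++⁺ˡ (∈-map⁺ (x ∷_) (filter∈Sublists P? xs))
  ... | false = ∈-++⁺ʳ (map (x ∷_) (Sublists xs)) (filter∈Sublists P? xs)

  Sublists-⊆ : ∀ xs {ys} → ys ∈ Sublists xs → ys ⊆ xs
  Sublists-⊆ []       (here refl) ()
  Sublists-⊆ (x ∷ xs) ys∈ with ∈-++⁻ (map (x ∷_) (Sublists xs)) (subst (_ ∈_) (Sublists-∷ x xs) ys∈)
  ... | inj₂ ys∈′ = there ∘ Sublists-⊆ xs ys∈′
  ... | inj₁ ys∈′ with ∈-map⁻ (x ∷_) ys∈′
  ... | zs , zs∈ , refl = λ { (here eq) → here eq ; (there y∈) → there (Sublists-⊆ xs zs∈ y∈) }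

  Sublists-unique : ∀ {xs} → Unique xs → ∀ {ys} → ys ∈ Sublists xs → Unique ys
  Sublists-unique {[]}     _            (here refl) = []
  Sublists-unique {x ∷ xs} (x∉xs ∷ xs!) ys∈
    with ∈-++⁻ (map (x ∷_) (Sublists xs)) (subst (_ ∈_) (Sublists-∷ x xs) ys∈)
  ... | inj₂ ys∈′ = Sublists-unique xs! ys∈′
  ... | inj₁ ys∈′ with ∈-map⁻ (x ∷_) ys∈′
  ... | zs , zs∈ , refl =
    All.tabulate (λ y∈ → All.lookup x∉xs (Sublists-⊆ xs zs∈ y∈)) ∷ Sublists-unique xs! zs∈

  -- The index of `best` ties the stored value to `divᵗ` of the stored list, so comparing with that
  -- value compares diversities.
  data IsBest (xss : List (List Point)) : Maybe (List Point × Carrier ⁺) → Set (c ⊔ ℓ₂) where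
    none : (∀ {xs} → xs ∈ xss → isFair xs ≢ true) → IsBest xss nothing
    best : ∀ {ys} → ys ∈ xss → isFair ys ≡ true →
           (∀ {xs} → xs ∈ xss → isFair xs ≡ true → value (divᵗ I xs) ≤⁺ value (divᵗ I ys)) →
           IsBest xss (just (ys , value (divᵗ I ys)))

  betterᵗ-best : ∀ {xs xss r} → isFair xs ≡ true → IsBest xss r →
                 IsBest (xs ∷ xss) (value (betterᵗ I xs (value (divᵗ I xs)) r))
  betterᵗ-best fair (none unfair) = best (here refl) fair
    λ { (here refl) _ → ≤⁺-refl ; (there zs∈) fair′ → contradiction fair′ (unfair zs∈) }
  betterᵗ-best {xs} fair (best {ys} ys∈ fair′ max) with ≤⁺-dec _≤?_ (value (divᵗ I xs)) (value (divᵗ I ys))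
  ... | yes e≤f = best (there ys∈) fair′ λ { (here refl) _ → e≤f ; (there zs∈) → max zs∈ }
  ... | no  e≰f = best (here refl) fair
    λ { (here refl) _ → ≤⁺-refl ; (there zs∈) fair″ → ≤⁺-trans (max zs∈ fair″) f≤e }
    where
    f≤e : value (divᵗ I ys) ≤⁺ value (divᵗ I xs)
    f≤e with ≤⁺-total (value (divᵗ I ys)) (value (divᵗ I xs))
    ... | inj₁ f≤e = f≤e
    ... | inj₂ e≤f = contradiction e≤f e≰f

  bestᵗ-best : ∀ xss → IsBest xss (value (bestᵗ I xss))
  bestᵗ-best []         = none λ ()
  bestᵗ-best (xs ∷ xss) with isFair xs in eq
  ... | true  = betterᵗ-best eq (bestᵗ-best xss)
  ... | false with value (bestᵗ I xss) | bestᵗ-best xss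
  ...   | _ | none unfair = none
          λ { (here refl) fair → contradiction (trans (sym fair) eq) λ () ; (there zs∈) → unfair zs∈ }
  ...   | _ | best ys∈ fair max = best (there ys∈) fair
          λ { (here refl) fair′ → contradiction (trans (sym fair′) eq) λ () ; (there zs∈) → max zs∈ }

  -- Rules out the outcome `nothing` of the search, and later yields that `kTotal` is at most `n`.
  full : Fair I Subset.⊤
  full i = subst (λ Y → k i ℕ.≤ ∣ Y ∣) (sym (∩-identityˡ (X i))) (k≤∣X∣ i)

  powerᵗ-value : ∀ x e → value (powerᵗ I x e) ≡ x ^ e
  powerᵗ-value x zero    = refl
  powerᵗ-value x (suc e) = cong (x *_) (powerᵗ-value x e)

  scalarᵗ-value : ∀ j → value (scalarᵗ I j) ≡ j · 1#
  scalarᵗ-value zero    = refl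
  scalarᵗ-value (suc j) = cong (1# +_) (scalarᵗ-value j)

  sumᵗ-value : ∀ is → value (sumᵗ I is) ≡ sum (map k is)
  sumᵗ-value []       = refl
  sumᵗ-value (i ∷ is) = cong (k i ℕ.+_) (sumᵗ-value is)

  -- When the fuel runs out, the hypothesis has become `x ≤ 0#`, which is what the answer zero
  -- requires.
  ceilingᵗ-upper : ∀ fuel {x} → x ≤ fuel · 1# → x ≤ value (ceilingᵗ I fuel x) · 1#
  ceilingᵗ-upper zero       x≤ = x≤
  ceilingᵗ-upper (suc fuel) {x} x≤ with x ≤? 0#
  ... | yes x≤0 = x≤0
  ... | no  _   = x-y≤z⇒x≤y+z (ceilingᵗ-upper fuel (x≤y+z⇒x-y≤z x≤))

  module _ {ε : Carrier} (0<ε : 0# < ε) {dim : ℕ} (doubling : Doubling I dim)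
           {s : ℕ} (large : Scales.base 0<ε ^ dim * (kTotal · 1#) ≤ s · 1#) where

    open Scales 0<ε
    open DecMembership (_≟_ {n}) using () renaming (_∈?_ to _∈ᴸ?_)

    𝒯 : List Point
    𝒯 = Coreset s

    -- `select` returns points of the coreset in no particular order; filtering the coreset by
    -- membership among them gives an enumerated list with the same points.
    fair-sublist : ∀ {S} → Fair I S → ∀ {L} (0<L : 0# < L) →
                   (∀ {u v} → u Subset.∈ S → v Subset.∈ S → u ≢ v → L ≤ d u v) →
                   ∃ λ xs → xs ∈ Sublists 𝒯 × isFair xs ≡ true × Separated (M 0<L) xs
    fair-sublist {S} fair {L} 0<L far = sublist
      (select 0<ε {dim} doubling {s} large 0<L (length-fairList {S} fair)
        (allPairs⁺ (fairList-unique {S} fair)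
          (λ u∈ v∈ → far (fairList-⊆ {S} fair u∈) (fairList-⊆ {S} fair v∈))))
      where
      sublist : (∃ λ us → map group us ↭ map group (fairList S) × All (λ u → u ∈ part s (group u)) us ×
                          Separated (M 0<L) us) →
                ∃ λ xs → xs ∈ Sublists 𝒯 × isFair xs ≡ true × Separated (M 0<L) xs
      sublist (us , us↭ , sel , sep) = xs , filter∈Sublists (_∈ᴸ? us) 𝒯 ,
        fairᵗ-complete {xs} (All.universal xs-fair (allFin m)) ,
        allPairs⁺ (Unique.filter⁺ (_∈ᴸ? us) (Coreset-unique s))
          (λ u∈ v∈ → allPairs-lookup swap-≤ sep (∈us u∈) (∈us v∈))
        where
        xs = filter (_∈ᴸ? us) 𝒯
        ∈us : ∀ {x} → x ∈ xs → x ∈ us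
        ∈us x∈ = proj₂ (∈-filter⁻ (_∈ᴸ? us) {xs = 𝒯} x∈)
        -- Since `M` is positive, no point can occur twice, so no count drops on passing from `us`
        -- to `xs`.
        us! : Unique us
        us! = AllPairs.map (λ { {x} M≤d refl → <⇒≱ (0<M 0<L) (≤-trans M≤d (≤-reflexive (≈⇒0 refl))) }) sep
        xs-fair : FairList xs
        xs-fair i = subst (k i ℕ.≤_) (sym (count-filter i xs)) (ℕ.≤-trans (k≤tally {S} fair i)
          (subst (ℕ._≤ length (filter (λ x → group x ≟ i) xs))
            (trans (sym (tally-map-group i us)) (↭-length (filter-↭ (_≟ i) us↭)))
            (unique-⊆⇒length≤ (Unique.filter⁺ (λ x → group x ≟ i) us!) λ {x} x∈ →
              let x∈us , gx≡i = ∈-filter⁻ (λ x → group x ≟ i) {xs = us} x∈ in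
              ∈-filter⁺ (λ x → group x ≟ i)
                (∈-filter⁺ (_∈ᴸ? us) (part⊆Coreset {s} (All.lookup sel x∈us)) x∈us) gx≡i)))

    diameter : Carrier
    diameter = Max.max 0# (map (λ (u , v) → d u v) (cartesianProduct (allFin n) (allFin n)))

    0≤diameter : 0# ≤ diameter
    0≤diameter = Max.⊥≤max 0# (map (λ (u , v) → d u v) (cartesianProduct (allFin n) (allFin n)))

    d≤diameter : ∀ u v → d u v ≤ diameter
    d≤diameter u v = All.lookup (Max.xs≤max 0# _)
      (∈-map⁺ (λ (u , v) → d u v) (∈-cartesianProduct⁺ (∈-allFin u) (∈-allFin v)))

    Approximates : Carrier ⁺ → Set _
    Approximates z = ∃ λ xs → xs ∈ Sublists 𝒯 × isFair xs ≡ true × z /⁺ (1# + ε) ≤⁺ value (divᵗ I xs)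

    approximate : ∀ {S} → Fair I S → Approximates (div I S)
    approximate {S} fair = by-cases (div I S) refl
      where
      by-cases : ∀ z → div I S ≡ z → Approximates z
      by-cases [ L ] eq =
        let xs , xs∈ , xs-fair , sep = fair-sublist {S} fair (div-pos {S} eq)
              (λ u∈ v∈ u≢v → [≤]-injective (subst (_≤⁺ _) eq (div-lower u∈ v∈ u≢v)))
        in xs , xs∈ , xs-fair , divᵗ-greatest (AllPairs.map [_]⁺ sep)
      -- A set without two distinct points is separated at every scale. `L` is chosen so that
      -- `L / (1 + ε)` is `diameter + 1`; a list separated by that much has no pairs at all, and its
      -- diversity is `⊤⁺`.
      by-cases ⊤⁺ eq =
        let xs , xs∈ , xs-fair , sep = fair-sublist {S} fair 0<L
              (λ u∈ v∈ u≢v → contradiction (subst (_≤⁺ _) eq (div-lower u∈ v∈ u≢v)) λ ())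
        in xs , xs∈ , xs-fair , divᵗ-greatest (AllPairs.map
             (λ {u} {v} M≤d → contradiction (≤-trans M≤d (d≤diameter u v)) (<⇒≱ diameter<M)) sep)
        where
        0<L : 0# < (diameter + 1#) * (1# + ε)
        0<L = *-pos (≤-<-trans 0≤diameter (x<x+1 diameter)) 0<1+ε
        diameter<M : diameter < M 0<L
        diameter<M = <-≤-trans (x<x+1 diameter) (≤-reflexive (≈.sym (≈.trans (*-assoc _ _ _)
          (≈.trans (*-congˡ (⁻¹-inverse (0<x⇒x≉0 0<1+ε))) (*-identityʳ _)))))

    Solves : Maybe (List Point) → Set _
    Solves r = ∃ λ xs → r ≡ just xs × ℓ* I /⁺ (1# + ε) ≤⁺ div I (⟦_⟧ I xs) × Fair I (⟦_⟧ I xs)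

    best-solves : ∀ {r} → IsBest (Sublists 𝒯) r → Solves (solution I r)
    best-solves (none unfair) =
      let xs , xs∈ , xs-fair , _ = approximate {Subset.⊤} full
      in contradiction xs-fair (unfair xs∈)
    best-solves (best {ys} ys∈ ys-fair max) = ys , refl , ratio ,
      fairList⇒fair (Sublists-unique (Coreset-unique s) ys∈)
        (λ i → All.lookup (fairᵗ-sound {ys} (allFin m) ys-fair) (∈-allFin i))
      where
      below : ∀ {z} → Approximates z → z /⁺ (1# + ε) ≤⁺ div I (⟦_⟧ I ys)
      below (xs , xs∈ , xs-fair , le) = ≤⁺-trans le (≤⁺-trans (max xs∈ xs-fair) (divᵗ≤div ys))
      ratio : ℓ* I /⁺ (1# + ε) ≤⁺ div I (⟦_⟧ I ys)
      -- The maximum is its default value or the diversity of an exact set. The default zero lies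
      -- below every diversity, so this case is settled without exhibiting an exact set.
      ratio = Sum.[ default , attained ]′ (argmax-sel id [ 0# ] (map (div I) (filter (exact? I) (allSubsets n))))
        where
        default : ℓ* I ≡ [ 0# ] → ℓ* I /⁺ (1# + ε) ≤⁺ div I (⟦_⟧ I ys)
        default ℓ*≡0 = subst (λ z → z /⁺ (1# + ε) ≤⁺ div I (⟦_⟧ I ys)) (sym ℓ*≡0)
          (≤⁺-trans [ ≤-reflexive (zeroˡ _) ]⁺ (div-nonNegative {⟦_⟧ I ys}))
        attained : ℓ* I ∈ map (div I) (filter (exact? I) (allSubsets n)) →
                   ℓ* I /⁺ (1# + ε) ≤⁺ div I (⟦_⟧ I ys)
        attained ℓ*∈ =
          let S , S∈ , ℓ*≡ = ∈-map⁻ (div I) ℓ*∈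
              exact = proj₂ (∈-filter⁻ (exact? I) {xs = allSubsets n} S∈)
          in subst (λ z → z /⁺ (1# + ε) ≤⁺ div I (⟦_⟧ I ys)) (sym ℓ*≡)
               (below (approximate {S} (λ i → ℕ.≤-reflexive (sym (exact i)))))

    correct : Solves (solution I (value (bestᵗ I (Sublists 𝒯))))
    correct = best-solves (bestᵗ-best (Sublists 𝒯))

  module _ {ε : Carrier} (0<ε : 0# < ε) {dim : ℕ} where

    open Scales 0<ε

    gmmSize-argument :
      value (powerᵗ I base dim) * value (scalarᵗ I (value (sumᵗ I (allFin m)))) ≡
      base ^ dim * (kTotal · 1#)
    gmmSize-argument = cong₂ _*_ (powerᵗ-value base dim)
      (trans (scalarᵗ-value (value (sumᵗ I (allFin m)))) (cong (_· 1#) (sumᵗ-value (allFin m))))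

    gmmSize-large : base ^ dim * (kTotal · 1#) ≤ value (gmmSize I dim ε) · 1#
    gmmSize-large = subst (_≤ value (gmmSize I dim ε) · 1#) gmmSize-argument
      (ceilingᵗ-upper (proj₁ (archimedean x)) (proj₂ (archimedean x)))
      where x = value (powerᵗ I base dim) * value (scalarᵗ I (value (sumᵗ I (allFin m))))

-- Step counts of the programs.

module Cost {c ℓ₁ ℓ₂} (F : ArchimedeanOrderedField c ℓ₁ ℓ₂) {m : ℕ}
  (I : FairDiversification.Instance F m) where

  open FairDiversification F
  open ArchimedeanOrderedField F using (0#; 1#; _·_; _≤?_) renaming (_≤_ to _≤ᶠ_)
  private module O = OrderedField F
  open Instance I
  open GMM F I
  open Selection F I
  open Correctness F I
  open import Data.Nat.Base using (_+_; _*_; _^_; _≤_; _<_)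
  open ℕ.≤-Reasoning

  extractFarthest-cost : ∀ z ws → cost (extractFarthest I z ws) ≡ 2 * length ws + 1
  extractFarthest-cost z []       = refl
  extractFarthest-cost z (w ∷ ws) = trans (cong (_+ 2) (extractFarthest-cost w ws)) (eq (length ws))
    where
    eq : ∀ l → 2 * l + 1 + 2 ≡ 2 * (1 + l) + 1
    eq = solve-∀

  retag-cost : ∀ y zs → cost (retag I y zs) ≡ 3 * length zs + 1
  retag-cost y []       = refl
  retag-cost y (_ ∷ zs) = trans (cong (λ j → 2 + (j + 1)) (retag-cost y zs)) (eq (length zs))
    where
    eq : ∀ l → 2 + (3 * l + 1 + 1) ≡ 3 * (1 + l) + 1
    eq = solve-∀

  tag-cost : ∀ y xs → cost (tag I y xs) ≡ 2 * length xs + 1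
  tag-cost y []       = refl
  tag-cost y (_ ∷ xs) = trans (cong (λ j → 1 + (j + 1)) (tag-cost y xs)) (eq (length xs))
    where
    eq : ∀ l → 1 + (2 * l + 1 + 1) ≡ 2 * (1 + l) + 1
    eq = solve-∀

  extend-length : ∀ s zs → length (value (extend I s zs)) ≤ s
  extend-length zero    zs       = z≤n
  extend-length (suc s) []       = z≤n
  extend-length (suc s) (z ∷ zs) = s≤s (extend-length s _)

  gmm-length : ∀ xs s → length (value (gmm I xs s)) ≤ s
  gmm-length xs       zero    = z≤n
  gmm-length []       (suc s) = z≤n
  gmm-length (x ∷ xs) (suc s) = s≤s (extend-length s _)

  -- A round on `l` further tags takes `2 * l + 1` steps for the extraction, `3 * l + 1` for
  -- retagging and one for the output; the last step is that of stopping.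
  extend-cost : ∀ {N} s zs → length zs ≤ N → cost (extend I s zs) ≤ s * (5 * N + 3) + 1
  extend-cost     zero    zs       _    = ℕ.≤-refl
  extend-cost     (suc s) []       _    = ℕ.m≤n+m 1 _
  extend-cost {N} (suc s) (z ∷ zs) zs<N = begin
    cost (extractFarthest I z zs) + (cost (retag I y rest) + (cost (extend I s rest′) + 1))
      ≤⟨ ℕ.+-mono-≤ (ℕ.≤-reflexive (extractFarthest-cost z zs)) (ℕ.+-mono-≤
           (ℕ.≤-reflexive (trans (retag-cost y rest) (cong (λ l → 3 * l + 1) |rest|)))
           (ℕ.+-monoˡ-≤ 1 (extend-cost s rest′ |rest′|≤N))) ⟩
    2 * l + 1 + (3 * l + 1 + (s * (5 * N + 3) + 1 + 1))
      ≡⟨ eq l s N ⟩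
    5 * l + 3 + s * (5 * N + 3) + 1
      ≤⟨ ℕ.+-monoˡ-≤ 1 (ℕ.+-monoˡ-≤ (s * (5 * N + 3)) (ℕ.+-monoˡ-≤ 3 (ℕ.*-monoʳ-≤ 5 (ℕ.<⇒≤ zs<N)))) ⟩
    5 * N + 3 + s * (5 * N + 3) + 1 ∎
    where
    l = length zs
    y = proj₁ (proj₁ (value (extractFarthest I z zs)))
    rest = proj₂ (value (extractFarthest I z zs))
    rest′ = value (retag I y rest)
    |rest| : length rest ≡ l
    |rest| = ℕ.suc-injective (↭-length (extractFarthest-↭ z zs))
    |rest′|≤N : length rest′ ≤ N
    |rest′|≤N = ℕ.≤-trans (ℕ.≤-reflexive (trans (sym (length-map proj₁ rest′))
      (trans (cong length (retag-points y rest)) (trans (length-map proj₁ rest) |rest|)))) (ℕ.<⇒≤ zs<N)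
    eq : ∀ l s N → 2 * l + 1 + (3 * l + 1 + (s * (5 * N + 3) + 1 + 1)) ≡ 5 * l + 3 + s * (5 * N + 3) + 1
    eq = solve-∀

  gmm-cost : ∀ {N} xs s → length xs ≤ N → cost (gmm I xs s) ≤ 2 * N + 3 + s * (5 * N + 3)
  gmm-cost {N} xs       zero    _    = ℕ.≤-trans (s≤s z≤n) (ℕ.≤-trans (ℕ.m≤n+m 3 (2 * N)) (ℕ.m≤m+n _ 0))
  gmm-cost {N} []       (suc s) _    = ℕ.≤-trans (s≤s z≤n) (ℕ.≤-trans (ℕ.m≤n+m 3 (2 * N)) (ℕ.m≤m+n _ _))
  gmm-cost {N} (x ∷ xs) (suc s) xs<N = begin
    cost (tag I x xs) + (cost (extend I s zs) + 1)
      ≤⟨ ℕ.+-mono-≤ (ℕ.≤-reflexive (tag-cost x xs)) (ℕ.+-monoˡ-≤ 1 (extend-cost s zs |zs|≤N)) ⟩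
    2 * length xs + 1 + (s * (5 * N + 3) + 1 + 1)
      ≤⟨ ℕ.+-monoˡ-≤ _ (ℕ.+-monoˡ-≤ 1 (ℕ.*-monoʳ-≤ 2 (ℕ.<⇒≤ xs<N))) ⟩
    2 * N + 1 + (s * (5 * N + 3) + 1 + 1)
      ≡⟨ eq N (s * (5 * N + 3)) ⟩
    2 * N + 3 + s * (5 * N + 3)
      ≤⟨ ℕ.+-monoʳ-≤ (2 * N + 3) (ℕ.*-monoˡ-≤ (5 * N + 3) (ℕ.n≤1+n s)) ⟩
    2 * N + 3 + suc s * (5 * N + 3) ∎
    where
    zs = value (tag I x xs)
    |zs|≤N : length zs ≤ N
    |zs|≤N = ℕ.≤-trans
      (ℕ.≤-reflexive (trans (sym (length-map proj₁ zs)) (cong length (tag-points x xs)))) (ℕ.<⇒≤ xs<N)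
    eq : ∀ N a → 2 * N + 1 + (a + 1 + 1) ≡ 2 * N + 3 + a
    eq = solve-∀

  membersᵗ-cost : ∀ i xs → cost (membersᵗ I i xs) ≡ 2 * length xs + 1
  membersᵗ-cost i []       = refl
  membersᵗ-cost i (x ∷ xs) = trans (cong (λ j → 1 + (j + 1)) (membersᵗ-cost i xs)) (eq (length xs))
    where
    eq : ∀ l → 1 + (2 * l + 1 + 1) ≡ 2 * (1 + l) + 1
    eq = solve-∀

  length-allFin : ∀ j → length (allFin j) ≡ j
  length-allFin j = length-tabulate {n = j} id

  unique-length : ∀ {xs} → Unique xs → length xs ≤ n
  unique-length {xs} xs! = ℕ.≤-trans
    (unique-⊆⇒length≤ {ys = allFin n} xs! (λ {x} _ → ∈-allFin x)) (ℕ.≤-reflexive (length-allFin n))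

  appendᵗ-cost : ∀ {a} {A : Set a} (xs ys : List A) → cost (appendᵗ I xs ys) ≡ length xs + 1
  appendᵗ-cost []       ys = refl
  appendᵗ-cost (x ∷ xs) ys = trans (cong (_+ 1) (appendᵗ-cost xs ys)) (ℕ.+-comm (length xs + 1) 1)

  -- A group costs `2 * n + 1` for listing its members, `2 * n + 3 + s * (5 * n + 3)` for GMM and at
  -- most `s + 1` for appending.
  coreset-cost : ∀ s is → cost (coreset I s is) ≤ length is * (4 * n + 5 + s * (5 * n + 4)) + 1
  coreset-cost s []       = ℕ.≤-refl
  coreset-cost s (i ∷ is) = begin
    cost (membersᵗ I i (allFin n)) + (cost (gmm I (members i) s) + (cost (coreset I s is) +
      cost (appendᵗ I (part s i) (value (coreset I s is)))))
      ≤⟨ ℕ.+-mono-≤ (ℕ.≤-reflexive (trans (membersᵗ-cost i (allFin n)) (cong (λ l → 2 * l + 1) (length-allFin n))))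
        (ℕ.+-mono-≤ (gmm-cost (members i) s (unique-length (members-unique i)))
        (ℕ.+-mono-≤ (coreset-cost s is) (ℕ.≤-trans
          (ℕ.≤-reflexive (appendᵗ-cost (part s i) _)) (ℕ.+-monoˡ-≤ 1 (gmm-length (members i) s))))) ⟩
    2 * n + 1 + (2 * n + 3 + s * (5 * n + 3) + (length is * perGroup + 1 + (s + 1)))
      ≡⟨ eq n s (length is * perGroup) ⟩
    perGroup + length is * perGroup + 1 ∎
    where
    perGroup = 4 * n + 5 + s * (5 * n + 4)
    eq : ∀ n s b → 2 * n + 1 + (2 * n + 3 + s * (5 * n + 3) + (b + 1 + (s + 1))) ≡
         4 * n + 5 + s * (5 * n + 4) + b + 1
    eq = solve-∀

  Coreset-length : ∀ s → length (Coreset s) ≤ m * s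
  Coreset-length s = subst₂ _≤_ (cong length (sym (coreset-value s (allFin m))))
    (cong (_* s) (length-allFin m)) (go (allFin m))
    where
    go : ∀ is → length (concatMap (part s) is) ≤ length is * s
    go []       = z≤n
    go (i ∷ is) = subst (_≤ _) (sym (length-++ (part s i))) (ℕ.+-mono-≤ (gmm-length (members i) s) (go is))

  powerᵗ-cost : ∀ x e → cost (powerᵗ I x e) ≡ e + 1
  powerᵗ-cost x zero    = refl
  powerᵗ-cost x (suc e) = trans (cong (_+ 1) (powerᵗ-cost x e)) (ℕ.+-comm (e + 1) 1)

  scalarᵗ-cost : ∀ j → cost (scalarᵗ I j) ≡ j + 1
  scalarᵗ-cost zero    = refl
  scalarᵗ-cost (suc j) = trans (cong (_+ 1) (scalarᵗ-cost j)) (ℕ.+-comm (j + 1) 1)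

  sumᵗ-cost : ∀ is → cost (sumᵗ I is) ≡ length is + 1
  sumᵗ-cost []       = refl
  sumᵗ-cost (i ∷ is) = trans (cong (_+ 1) (sumᵗ-cost is)) (ℕ.+-comm (length is + 1) 1)

  -- The fuel is an unspecified Archimedean bound that could be far too large, but the loop stops
  -- once its argument is at most `0#`. Any natural bound `N` of the argument thus limits the
  -- rounds, at three steps each.
  ceilingᵗ-bounds : ∀ fuel {x} N → x ≤ᶠ N · 1# →
                    value (ceilingᵗ I fuel x) ≤ N × cost (ceilingᵗ I fuel x) ≤ 3 * N + 2
  ceilingᵗ-bounds zero       N x≤N = z≤n , ℕ.≤-trans (s≤s z≤n) (ℕ.m≤n+m 2 (3 * N))
  ceilingᵗ-bounds (suc fuel) {x} N x≤N with x ≤? 0#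
  ceilingᵗ-bounds (suc fuel) N       x≤N | yes _   = z≤n , ℕ.m≤n+m 2 (3 * N)
  ceilingᵗ-bounds (suc fuel) zero    x≤0 | no x≰0  = contradiction x≤0 x≰0
  ceilingᵗ-bounds (suc fuel) (suc N) x≤N | no _    =
    let v≤ , c≤ = ceilingᵗ-bounds fuel N (O.x≤y+z⇒x-y≤z x≤N)
    in s≤s v≤ , ℕ.≤-trans (ℕ.+-monoʳ-≤ 2 (ℕ.+-monoˡ-≤ 1 c≤)) (ℕ.≤-reflexive (eq N))
    where
    eq : ∀ N → 2 + (3 * N + 2 + 1) ≡ 3 * (1 + N) + 2
    eq = solve-∀

  consAllᵗ-cost : ∀ x yss → cost (consAllᵗ I x yss) ≡ length yss + 1
  consAllᵗ-cost x []         = refl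
  consAllᵗ-cost x (ys ∷ yss) = trans (cong (_+ 1) (consAllᵗ-cost x yss)) (ℕ.+-comm (length yss + 1) 1)

  Sublists-length : ∀ xs → length (Sublists xs) ≡ 2 ^ length xs
  Sublists-length []       = refl
  Sublists-length (x ∷ xs) = trans (cong length (Sublists-∷ x xs))
    (trans (length-++ (map (x ∷_) (Sublists xs)))
      (cong₂ _+_ (trans (length-map (x ∷_) (Sublists xs)) (Sublists-length xs))
                 (trans (Sublists-length xs) (sym (ℕ.+-identityʳ _)))))

  -- One more point on top of `w` sublists costs `w + 1` steps for `consAllᵗ` and as many for
  -- `appendᵗ`; the `w` form a geometric series.
  sublistsᵗ-cost : ∀ xs → cost (sublistsᵗ I xs) ≤ 2 * 2 ^ length xs + 2 * length xs
  sublistsᵗ-cost []       = s≤s z≤n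
  sublistsᵗ-cost (x ∷ xs) = begin
    cost (sublistsᵗ I xs) + (cost (consAllᵗ I x yss) + cost (appendᵗ I (value (consAllᵗ I x yss)) yss))
      ≤⟨ ℕ.+-mono-≤ (sublistsᵗ-cost xs) (ℕ.≤-reflexive (cong₂ _+_
          (trans (consAllᵗ-cost x yss) (cong (_+ 1) (Sublists-length xs)))
          (trans (appendᵗ-cost (value (consAllᵗ I x yss)) yss) (cong (_+ 1)
            (trans (cong length (consAllᵗ-value x yss))
              (trans (length-map (x ∷_) yss) (Sublists-length xs))))))) ⟩
    2 * w + 2 * length xs + (w + 1 + (w + 1))
      ≡⟨ eq w (length xs) ⟩
    2 * (2 * w) + 2 * (1 + length xs) ∎
    where
    w = 2 ^ length xs
    yss = Sublists xs
    eq : ∀ w l → 2 * w + 2 * l + (w + 1 + (w + 1)) ≡ 2 * (2 * w) + 2 * (1 + l)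
    eq = solve-∀

  countᵗ-cost : ∀ i xs → cost (countᵗ I i xs) ≡ 2 * length xs + 1
  countᵗ-cost i []       = refl
  countᵗ-cost i (x ∷ xs) = trans (cong (λ j → 1 + (j + 1)) (countᵗ-cost i xs)) (eq (length xs))
    where
    eq : ∀ l → 1 + (2 * l + 1 + 1) ≡ 2 * (1 + l) + 1
    eq = solve-∀

  fairᵗ-cost : ∀ xs is → cost (fairᵗ I xs is) ≡ length is * (2 * length xs + 3) + 1
  fairᵗ-cost xs []       = refl
  fairᵗ-cost xs (i ∷ is) = trans
    (cong₂ (λ a b → a + (1 + (b + 1))) (countᵗ-cost i xs) (fairᵗ-cost xs is))
    (eq (length xs) (length is))
    where
    eq : ∀ t l → 2 * t + 1 + (1 + (l * (2 * t + 3) + 1 + 1)) ≡ (1 + l) * (2 * t + 3) + 1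
    eq = solve-∀

  nearestᵗ-cost : ∀ x ys → cost (nearestᵗ I x ys) ≡ 3 * length ys + 1
  nearestᵗ-cost x []       = refl
  nearestᵗ-cost x (y ∷ ys) = trans (cong (λ j → 1 + (j + 2)) (nearestᵗ-cost x ys)) (eq (length ys))
    where
    eq : ∀ l → 1 + (3 * l + 1 + 2) ≡ 3 * (1 + l) + 1
    eq = solve-∀

  divᵗ-cost : ∀ {t} xs → length xs ≤ t → cost (divᵗ I xs) ≤ length xs * (3 * t + 3) + 1
  divᵗ-cost     []       _    = ℕ.≤-refl
  divᵗ-cost {t} (x ∷ xs) xs<t = begin
    cost (nearestᵗ I x xs) + (cost (divᵗ I xs) + 2)
      ≤⟨ ℕ.+-mono-≤ (ℕ.≤-reflexive (nearestᵗ-cost x xs)) (ℕ.+-monoˡ-≤ 2 (divᵗ-cost xs (ℕ.<⇒≤ xs<t))) ⟩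
    3 * length xs + 1 + (length xs * (3 * t + 3) + 1 + 2)
      ≤⟨ ℕ.+-monoˡ-≤ _ (ℕ.+-monoˡ-≤ 1 (ℕ.*-monoʳ-≤ 3 (ℕ.<⇒≤ xs<t))) ⟩
    3 * t + 1 + (length xs * (3 * t + 3) + 1 + 2)
      ≡⟨ eq t (length xs * (3 * t + 3)) ⟩
    3 * t + 3 + length xs * (3 * t + 3) + 1 ∎
    where
    eq : ∀ t b → 3 * t + 1 + (b + 1 + 2) ≡ 3 * t + 3 + b + 1
    eq = solve-∀

  betterᵗ-cost : ∀ xs e r → cost (betterᵗ I xs e r) ≤ 2
  betterᵗ-cost xs e nothing  = s≤s z≤n
  betterᵗ-cost xs e (just _) = ℕ.≤-refl

  -- The summands belong to the fairness test, the diversity, and the comparison with the best list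
  -- so far.
  perSublist : ℕ → ℕ
  perSublist t = m * (2 * t + 3) + 1 + (t * (3 * t + 3) + 1 + 2)

  bestᵗ-cost : ∀ {t} xss → All (λ xs → length xs ≤ t) xss → cost (bestᵗ I xss) ≤ length xss * perSublist t + 1
  bestᵗ-cost     []         []           = ℕ.≤-refl
  bestᵗ-cost {t} (xs ∷ xss) (xs≤ ∷ xss≤) = begin
    cost (bestᵗ I xss) + (cost (fairᵗ I xs (allFin m)) + cost (branch (isFair xs)))
      ≤⟨ ℕ.+-mono-≤ (bestᵗ-cost xss xss≤) (ℕ.+-mono-≤ fair≤ (branch≤ (isFair xs))) ⟩
    length xss * perSublist t + 1 + perSublist t
      ≡⟨ eq (length xss * perSublist t) (perSublist t) ⟩
    perSublist t + length xss * perSublist t + 1 ∎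
    where
    -- The conditional of `bestᵗ` as a function of its test, so that both outcomes can be bounded
    -- without evaluating the test.
    branch : Bool → Timed _
    branch b = if b
      then (divᵗ I xs >>= λ e → betterᵗ I xs e (value (bestᵗ I xss)))
      else step (value (bestᵗ I xss))
    branch≤ : ∀ b → cost (branch b) ≤ t * (3 * t + 3) + 1 + 2
    branch≤ true  = ℕ.+-mono-≤ (ℕ.≤-trans (divᵗ-cost xs xs≤) (ℕ.+-monoˡ-≤ 1 (ℕ.*-monoˡ-≤ (3 * t + 3) xs≤)))
                               (betterᵗ-cost xs _ (value (bestᵗ I xss)))
    branch≤ false = ℕ.≤-trans (s≤s z≤n) (ℕ.m≤n+m 2 _)
    fair≤ : cost (fairᵗ I xs (allFin m)) ≤ m * (2 * t + 3) + 1
    fair≤ = ℕ.≤-trans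
      (ℕ.≤-reflexive (trans (fairᵗ-cost xs (allFin m))
        (cong (λ l → l * (2 * length xs + 3) + 1) (length-allFin m))))
      (ℕ.+-monoˡ-≤ 1 (ℕ.*-monoʳ-≤ m (ℕ.+-monoˡ-≤ 3 (ℕ.*-monoʳ-≤ 2 xs≤))))
    eq : ∀ a b → a + 1 + b ≡ b + a + 1
    eq = solve-∀

  -- The fair list cut from the whole space consists of `kTotal` distinct points.
  kTotal≤n : kTotal ≤ n
  kTotal≤n = subst (_≤ n) (length-fairList {Subset.⊤} full) (unique-length (fairList-unique {Subset.⊤} full))

  -- With `w` for `2 ^ e`, both `1` and `e` are at most `w`, so the quadratic work on a sublist is a
  -- multiple of `w * w` and the work on all of them a multiple of `w³`. The factor `5 * m + 16` is
  -- below the power of two with that exponent.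
  enumeration-cost : ∀ {e} xs → Unique xs → length xs ≤ e →
    cost (sublistsᵗ I xs) + (cost (bestᵗ I (Sublists xs)) + 1) ≤ 2 ^ (5 * m + 16 + 3 * e)
  enumeration-cost {e} xs xs! xs≤e = begin
    cost (sublistsᵗ I xs) + (cost (bestᵗ I (Sublists xs)) + 1)
      ≤⟨ ℕ.+-mono-≤
           (ℕ.≤-trans (sublistsᵗ-cost xs) (ℕ.+-mono-≤ (ℕ.*-monoʳ-≤ 2 2^≤) (ℕ.*-monoʳ-≤ 2 (ℕ.≤-trans xs≤e e≤w))))
           (ℕ.+-monoˡ-≤ 1 (ℕ.≤-trans (bestᵗ-cost (Sublists xs) short)
             (ℕ.+-monoˡ-≤ 1 (ℕ.*-mono-≤ (ℕ.≤-trans (ℕ.≤-reflexive (Sublists-length xs)) 2^≤) perSublist≤)))) ⟩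
    2 * w + 2 * w + (w * ((5 * m + 10) * (w * w)) + 1 + 1)
      ≡⟨ eq₁ m w ⟩
    4 * w + (5 * m + 10) * w³ + 2
      ≤⟨ ℕ.+-mono-≤ (ℕ.+-monoˡ-≤ _ (ℕ.*-monoʳ-≤ 4 w≤w³)) (ℕ.*-monoʳ-≤ 2 (ℕ.≤-trans 1≤w w≤w³)) ⟩
    4 * w³ + (5 * m + 10) * w³ + 2 * w³
      ≡⟨ eq₂ m w³ ⟩
    (5 * m + 16) * w³
      ≤⟨ ℕ.*-monoˡ-≤ w³ (ℕ.<⇒≤ (m<2^m (5 * m + 16))) ⟩
    2 ^ (5 * m + 16) * w³
      ≡⟨ cong (2 ^ (5 * m + 16) *_) (trans (eq₃ w) (ℕ.^-*-assoc 2 e 3)) ⟩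
    2 ^ (5 * m + 16) * 2 ^ (e * 3)
      ≡⟨ ℕ.^-distribˡ-+-* 2 (5 * m + 16) (e * 3) ⟨
    2 ^ (5 * m + 16 + e * 3)
      ≡⟨ cong (λ a → 2 ^ (5 * m + 16 + a)) (ℕ.*-comm e 3) ⟩
    2 ^ (5 * m + 16 + 3 * e) ∎
    where
    w  = 2 ^ e
    w³ = w * (w * w)
    1≤w : 1 ≤ w
    1≤w = ℕ.m^n>0 2 e
    e≤w : e ≤ w
    e≤w = ℕ.<⇒≤ (m<2^m e)
    1≤w² : 1 ≤ w * w
    1≤w² = ℕ.*-mono-≤ 1≤w 1≤w
    w≤w² : w ≤ w * w
    w≤w² = subst (_≤ w * w) (ℕ.*-identityʳ w) (ℕ.*-monoʳ-≤ w 1≤w)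
    w≤w³ : w ≤ w³
    w≤w³ = subst (_≤ w³) (ℕ.*-identityʳ w) (ℕ.*-monoʳ-≤ w 1≤w²)
    2^≤ : 2 ^ length xs ≤ w
    2^≤ = ℕ.^-monoʳ-≤ 2 xs≤e
    short : All (λ ys → length ys ≤ e) (Sublists xs)
    short = All.tabulate λ ys∈ → ℕ.≤-trans
      (unique-⊆⇒length≤ (Sublists-unique xs! ys∈) (Sublists-⊆ xs ys∈)) xs≤e
    eq₁ : ∀ m w → 2 * w + 2 * w + (w * ((5 * m + 10) * (w * w)) + 1 + 1) ≡
          4 * w + (5 * m + 10) * (w * (w * w)) + 2
    eq₁ = solve-∀
    eq₂ : ∀ m x → 4 * x + (5 * m + 10) * x + 2 * x ≡ (5 * m + 16) * x
    eq₂ = solve-∀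
    -- The right side is `w ^ 3` unfolded, which `ℕ.^-*-assoc` then turns into a single power of
    -- two.
    eq₃ : ∀ w → w * (w * w) ≡ w * (w * (w * 1))
    eq₃ = solve-∀
    eq₄ : ∀ m x → m * (2 * x + 3 * x) + x + (3 * x + 3 * x + x + 2 * x) ≡ (5 * m + 10) * x
    eq₄ = solve-∀
    eq₅ : ∀ e → e * (3 * e + 3) ≡ 3 * (e * e) + 3 * e
    eq₅ = solve-∀
    perSublist≤ : perSublist e ≤ (5 * m + 10) * (w * w)
    perSublist≤ = begin
      m * (2 * e + 3) + 1 + (e * (3 * e + 3) + 1 + 2)
        ≡⟨ cong (λ a → m * (2 * e + 3) + 1 + (a + 1 + 2)) (eq₅ e) ⟩
      m * (2 * e + 3) + 1 + (3 * (e * e) + 3 * e + 1 + 2)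
        ≤⟨ ℕ.+-mono-≤ (ℕ.+-mono-≤ (ℕ.*-monoʳ-≤ m (ℕ.+-mono-≤ (ℕ.*-monoʳ-≤ 2 e≤w²) (ℕ.*-monoʳ-≤ 3 1≤w²))) 1≤w²)
             (ℕ.+-mono-≤ (ℕ.+-mono-≤ (ℕ.+-mono-≤
                (ℕ.*-monoʳ-≤ 3 (ℕ.*-mono-≤ e≤w e≤w)) (ℕ.*-monoʳ-≤ 3 e≤w²)) 1≤w²) (ℕ.*-monoʳ-≤ 2 1≤w²)) ⟩
      m * (2 * (w * w) + 3 * (w * w)) + w * w + (3 * (w * w) + 3 * (w * w) + w * w + 2 * (w * w))
        ≡⟨ eq₄ m (w * w) ⟩
      (5 * m + 10) * (w * w) ∎
      where
      e≤w² : e ≤ w * w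
      e≤w² = ℕ.≤-trans e≤w w≤w²

  module _ (1≤k : 1 ≤ kTotal) {s P : ℕ} (s≤ : s ≤ P * kTotal) where

    private
      K = kTotal
      z = n * K
      n≤z : n ≤ z
      n≤z = subst (_≤ z) (ℕ.*-identityʳ n) (ℕ.*-monoʳ-≤ n 1≤k)
      1≤n : 1 ≤ n
      1≤n = ℕ.≤-trans 1≤k kTotal≤n
      1≤z : 1 ≤ z
      1≤z = ℕ.≤-trans 1≤n n≤z
      K≤z : K ≤ z
      K≤z = ℕ.≤-trans kTotal≤n n≤z
      -- From `1 ≤ k ≤ n` it follows that `n * K` is at least one, so additive constants become
      -- multiples of it.
      c≤c*z : ∀ c → c ≤ c * z
      c≤c*z c = subst (_≤ c * z) (ℕ.*-identityʳ c) (ℕ.*-monoʳ-≤ c 1≤z)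

    -- The dominant product of `s` and `n` is linear in `n * K` because `s` is at most `P * K`.
    coreset-cost-linear : cost (coreset I s (allFin m)) ≤ (m * (9 + 9 * P) + 1) * z
    coreset-cost-linear = begin
      cost (coreset I s (allFin m))
        ≤⟨ coreset-cost s (allFin m) ⟩
      length (allFin m) * (4 * n + 5 + s * (5 * n + 4)) + 1
        ≡⟨ cong (λ l → l * (4 * n + 5 + s * (5 * n + 4)) + 1) (length-allFin m) ⟩
      m * (4 * n + 5 + s * (5 * n + 4)) + 1
        ≤⟨ ℕ.+-mono-≤ (ℕ.*-monoʳ-≤ m (ℕ.+-mono-≤ (ℕ.+-mono-≤ (ℕ.*-monoʳ-≤ 4 n≤z) (c≤c*z 5))
             (ℕ.*-mono-≤ s≤ (ℕ.+-monoʳ-≤ (5 * n) (ℕ.*-monoʳ-≤ 4 1≤n))))) 1≤z ⟩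
      m * (4 * z + 5 * z + P * K * (5 * n + 4 * n)) + z
        ≡⟨ eq m n P K ⟩
      (m * (9 + 9 * P) + 1) * z ∎
      where
      eq : ∀ m n P K → m * (4 * (n * K) + 5 * (n * K) + P * K * (5 * n + 4 * n)) + n * K ≡
           (m * (9 + 9 * P) + 1) * (n * K)
      eq = solve-∀

    -- The left side follows the program `gmmSize`: five field operations, the power, the sum, the
    -- conversion of `k`, a product and the ceiling.
    parameters-cost : ∀ dim → 5 + (dim + 1 + (m + 1 + (K + 1 + (1 + (3 * (P * K) + 2))))) ≤
                      (dim + m + 12 + 3 * P) * z
    parameters-cost dim = begin
      5 + (dim + 1 + (m + 1 + (K + 1 + (1 + (3 * (P * K) + 2)))))  ≡⟨ eq₁ dim m K (P * K) ⟩
      dim + m + 11 + K + 3 * (P * K)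
        ≤⟨ ℕ.+-mono-≤ (ℕ.+-mono-≤ (c≤c*z (dim + m + 11)) K≤z) (ℕ.*-monoʳ-≤ 3 (ℕ.*-monoʳ-≤ P K≤z)) ⟩
      (dim + m + 11) * z + z + 3 * (P * z)                     ≡⟨ eq₂ dim m P z ⟩
      (dim + m + 12 + 3 * P) * z                               ∎
      where
      eq₁ : ∀ dim m K a → 5 + (dim + 1 + (m + 1 + (K + 1 + (1 + (3 * a + 2))))) ≡ dim + m + 11 + K + 3 * a
      eq₁ = solve-∀
      eq₂ : ∀ dim m P z → (dim + m + 11) * z + z + 3 * (P * z) ≡ (dim + m + 12 + 3 * P) * z
      eq₂ = solve-∀

    -- As `K` is at least one, the constant part of the exponent is also bounded by a multiple of
    -- `K`.
    search-cost : cost (sublistsᵗ I (Coreset s)) + (cost (bestᵗ I (Sublists (Coreset s))) + 1) ≤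
                  2 ^ ((5 * m + 16 + 3 * (m * P)) * K)
    search-cost = ℕ.≤-trans
      (enumeration-cost (Coreset s) (Coreset-unique s) (ℕ.≤-trans (Coreset-length s) (ℕ.*-monoʳ-≤ m s≤)))
      (ℕ.^-monoʳ-≤ 2 (begin
        5 * m + 16 + 3 * (m * (P * K))
          ≤⟨ ℕ.+-monoˡ-≤ _ (subst (_≤ (5 * m + 16) * K)
               (ℕ.*-identityʳ (5 * m + 16)) (ℕ.*-monoʳ-≤ (5 * m + 16) 1≤k)) ⟩
        (5 * m + 16) * K + 3 * (m * (P * K))
          ≡⟨ eq m P K ⟩
        (5 * m + 16 + 3 * (m * P)) * K ∎))
      where
      eq : ∀ m P K → (5 * m + 16) * K + 3 * (m * (P * K)) ≡ (5 * m + 16 + 3 * (m * P)) * K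
      eq = solve-∀

-- The size passed to GMM is linear in `k`.

module Size {c ℓ₁ ℓ₂} (F : ArchimedeanOrderedField c ℓ₁ ℓ₂) {m : ℕ}
  (I : FairDiversification.Instance F m) where

  open FairDiversification F
  open ArchimedeanOrderedField F hiding (refl; sym; trans)
  open OrderedField F
  open Instance I
  open Correctness F I
  open Cost F I
  open ≤-Reasoning

  module _ {ε : Carrier} (0<ε : 0# < ε) {dim P : ℕ} (base^dim≤P : Scales.base 0<ε ^ dim ≤ P · 1#) where

    open Scales 0<ε

    private
      x : Carrier
      x = value (powerᵗ I base dim) * value (scalarᵗ I (value (sumᵗ I (allFin m))))

    x≤Pk : x ≤ (P ℕ.* kTotal) · 1#
    x≤Pk = begin
      x                             ≡⟨ gmmSize-argument 0<ε {dim} ⟩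
      base ^ dim * (kTotal · 1#)    ≤⟨ *-monoʳ-≤ (0≤n·1 kTotal) base^dim≤P ⟩
      (P · 1#) * (kTotal · 1#)      ≈⟨ ×1-homo-* P kTotal ⟨
      (P ℕ.* kTotal) · 1#           ∎

    -- `P * k` is itself a natural number above the argument, so rounding up does not exceed it.
    gmmSize-value : value (gmmSize I dim ε) ℕ.≤ P ℕ.* kTotal
    gmmSize-value = proj₁ (ceilingᵗ-bounds (proj₁ (archimedean x)) (P ℕ.* kTotal) x≤Pk)

    gmmSize-cost : cost (gmmSize I dim ε) ℕ.≤
      5 ℕ.+ (dim ℕ.+ 1 ℕ.+ (m ℕ.+ 1 ℕ.+ (kTotal ℕ.+ 1 ℕ.+ (1 ℕ.+ (3 ℕ.* (P ℕ.* kTotal) ℕ.+ 2)))))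
    gmmSize-cost = ℕ.+-monoʳ-≤ 5 (ℕ.+-mono-≤ (ℕ.≤-reflexive (powerᵗ-cost base dim))
      (ℕ.+-mono-≤ (ℕ.≤-reflexive (trans (sumᵗ-cost (allFin m)) (cong (ℕ._+ 1) (length-allFin m))))
      (ℕ.+-mono-≤ (ℕ.≤-reflexive (trans (scalarᵗ-cost (value (sumᵗ I (allFin m))))
                                        (cong (ℕ._+ 1) (sumᵗ-value (allFin m)))))
      (ℕ.+-monoʳ-≤ 1 (proj₂ (ceilingᵗ-bounds (proj₁ (archimedean x)) (P ℕ.* kTotal) x≤Pk))))))

mainTheorem7 : ∀ {c ℓ₁ ℓ₂} (F : ArchimedeanOrderedField c ℓ₁ ℓ₂) →
    let open ArchimedeanOrderedField F
        open FairDiversification F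
        open Instance in
    (m dim : ℕ) (ε : Carrier) → 0# < ε → ε ≤ 1# →
    ∃ λ (C : ℕ) → (I : Instance m) → IsDoublingDimension I dim →
      (∃ λ (S : List (Fin (n I))) →
        (value (fairMaxMin I dim ε) ≡ just S) ×
        (ℓ* I /⁺ (1# + ε) ≤⁺ div I (⟦_⟧ I S)) ×
        Fair I (⟦_⟧ I S)) ×
      (1 ℕ.≤ kTotal I →
        cost (fairMaxMin I dim ε) ℕ.≤ C ℕ.* (n I ℕ.* kTotal I) ℕ.+ 2 ℕ.^ (C ℕ.* kTotal I))
mainTheorem7 F m dim ε 0<ε ε≤1 = C₁ ℕ.+ C₂ , λ I (doubling , _) →
  Correctness.correct F I 0<ε {dim} doubling (Correctness.gmmSize-large F I 0<ε {dim}) , bound I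
  where
  open OrderedField F
  open ArchimedeanOrderedField F hiding (refl; sym; trans)
  open FairDiversification F
  open Instance
  open Scales 0<ε
  -- `P` bounds `(4/ε′)^λ` and depends on `ε` and `dim` alone, so all constants are fixed before the
  -- instance. `C₁` adds the factors for computing the size and the coreset; `C₂` is the factor in
  -- the exponent of the search.
  P C₁ C₂ : ℕ
  P = proj₁ (archimedean (base ^ dim))
  C₁ = (dim ℕ.+ m ℕ.+ 12 ℕ.+ 3 ℕ.* P) ℕ.+ (m ℕ.* (9 ℕ.+ 9 ℕ.* P) ℕ.+ 1)
  C₂ = 5 ℕ.* m ℕ.+ 16 ℕ.+ 3 ℕ.* (m ℕ.* P)

  assemble : ∀ {g c t a₁ a₂ z x} → g ℕ.≤ a₁ ℕ.* z → c ℕ.≤ a₂ ℕ.* z → t ℕ.≤ x →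
             g ℕ.+ (c ℕ.+ t) ℕ.≤ (a₁ ℕ.+ a₂) ℕ.* z ℕ.+ x
  assemble {g} {c} {t} {a₁} {a₂} {z} {x} g≤ c≤ t≤ = subst₂ ℕ._≤_ (ℕ.+-assoc g c t)
    (cong (ℕ._+ x) (sym (ℕ.*-distribʳ-+ z a₁ a₂)))
    (ℕ.+-mono-≤ (ℕ.+-mono-≤ g≤ c≤) t≤)

  bound : (I : Instance m) → 1 ℕ.≤ kTotal I →
          cost (fairMaxMin I dim ε) ℕ.≤
          (C₁ ℕ.+ C₂) ℕ.* (n I ℕ.* kTotal I) ℕ.+ 2 ℕ.^ ((C₁ ℕ.+ C₂) ℕ.* kTotal I)
  bound I 1≤k = ℕ.≤-trans
    (assemble {a₁ = dim ℕ.+ m ℕ.+ 12 ℕ.+ 3 ℕ.* P} {a₂ = m ℕ.* (9 ℕ.+ 9 ℕ.* P) ℕ.+ 1}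
      (ℕ.≤-trans (gmmSize-cost 0<ε {dim} {P} b≤P) (parameters-cost 1≤k {P = P} s≤ dim))
      (coreset-cost-linear 1≤k {P = P} s≤)
      (search-cost 1≤k {P = P} s≤))
    -- A single constant is claimed for both terms, so each of `C₁` and `C₂` is enlarged to their
    -- sum.
    (ℕ.+-mono-≤ (ℕ.*-monoˡ-≤ (n I ℕ.* kTotal I) (ℕ.m≤m+n C₁ C₂))
                (ℕ.^-monoʳ-≤ 2 (ℕ.*-monoˡ-≤ (kTotal I) (ℕ.m≤n+m C₂ C₁))))
    where
    open Cost F I
    open Size F I
    b≤P = proj₂ (archimedean (base ^ dim))
    s≤ : value (gmmSize I dim ε) ℕ.≤ P ℕ.* kTotal I
    s≤ = gmmSize-value 0<ε {dim} {P} b≤P
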